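{- Assume $\mathbf{P.0}$ has an optimal solution, with optimal value $OPT$. Let $A^g$ be the output of the greedy algorithm on the family $\mathcal{I}$. Then $|A^g|\le b$, $\lfloor\alpha_t\rfloor\le |A^g\cap V_t|\le\lceil\beta_t\rceil$ for all $t\in[m]$, and $$f(A^g)\ge \frac{(1-1/e)^2}{2}\,OPT.$$
   Context: Let $V$ be a finite set of $n$ items and $f:2^V\to\mathbb{R}_{\ge 0}$ a non-negative monotone submodular function. Items are divided into pairwise disjoint groups $V_1,\dots,V_m$ with $V=V_1\cup\dots\cup V_m$; $\alpha,\beta\in\mathbb{R}_{\ge 0}^m$ and $b$ is a positive integer. Let $\mathcal{F}=\{S\subseteq V: |S|\le b\}$. Problem $\mathbf{P.0}$: maximize $\sum_{S\in\mathcal{F}} x_S f(S)$ over $x\in[0,1]^{\mathcal{F}}$ subject to $\alpha_t\le \sum_{S\in\mathcal{F}} x_S |S\cap V_t|\le \beta_t$ for all $t\in[m]$ and $\sum_{S\in\mathcal{F}}x_S\le 1$; $OPT$ denotes its optimal value. Let $\mathcal{I}$ be the family of sets $S\subseteq V$ such that $|S\cap V_t|\le\lceil\beta_t\rceil$ for all $t\in[m]$ and $\sum_{t\in[m]}\max\{\lfloor\alpha_t\rfloor,|S\cap V_t|\}\le b$ (this family is the set of feasible solutions of problem $\mathbf{P.3}$: maximize $f(S)$ over $S\in\mathcal{I}$). The greedy algorithm on $\mathcal{I}$: start with $S=\emptyset$; while there exists $e\in V\setminus S$ with $S\cup\{e\}\in\mathcal{I}$, add to $S$ such an $e$ maximizing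 $f(S\cup\{e\})-f(S)$ (ties broken arbitrarily); when no such $e$ exists, output $A^g=S$. -}

module Defs where

open import Data.Fin.Base using (Fin)
open import Data.Fin.Subset using (Subset; inside; outside; _∈_; _∉_; _⊆_; _∩_; _∪_; ⁅_⁆; Empty; ∣_∣)
  renaming (⊥ to ∅)
import Data.Integer.Base as ℤ
import Data.Integer.Properties as ℤ
open import Data.List.Base using (List; []; _∷_; [_]; map; _++_; filter; foldr)
open import Data.Nat.Base as ℕ using (ℕ; zero; suc; _!)
import Data.Nat.Properties as ℕ
open import Data.Product.Base using (∃-syntax; Σ-syntax; _×_; _,_; proj₁; proj₂)
open import Data.Rational.Base as ℚ using (ℚ; 0ℚ; 1ℚ; ½)
import Data.Rational.Properties as ℚ
import Data.Rational.Unnormalised.Base as ℚᵘ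
import Data.Rational.Unnormalised.Properties as ℚᵘ
open import Data.Sum.Base using (inj₁; inj₂)
import Data.Vec.Base as Vec
open import Relation.Binary.Construct.Closure.ReflexiveTransitive using (Star)
open import Relation.Binary.PropositionalEquality using (_≡_; _≢_; refl; sym; trans; cong; cong₂; subst)
open import Relation.Nullary using (¬_)

open import Algebra.Properties.CommutativeMonoid.Sum ℕ.+-0-commutativeMonoid
  using () renaming (sum to sumℕ)

------------------------------------------------------------------------
-- Cauchy sequences of rationals

Cauchy : (ℕ → ℚ) → Set
Cauchy x = ∀ ε → 0ℚ ℚ.< ε →
  ∃[ N ] (∀ m n → N ℕ.≤ m → N ℕ.≤ n → ℚ.∣ x m ℚ.- x n ∣ ℚ.≤ ε)

module CauchyLemmas where

  open import Data.Rational.Base using (_+_; _*_; _-_; -_; _/_; 1/_; _≤_; _<_; _⊔_; NonNegative; NonZero)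
  open import Data.Rational.Solver using (module +-*-Solver)
  open +-*-Solver using (solve; _:=_; _:+_; _:*_; _:-_; :-_; con)

  ∣_∣q : ℚ → ℚ
  ∣_∣q = ℚ.∣_∣

  -- Inverses are passed around as K′ with K * K′ ≡ 1.
  inv : ∀ K → 0ℚ < K → Σ[ K′ ∈ ℚ ] (K * K′ ≡ 1ℚ × 0ℚ < K′)
  inv K K>0 = (1/ K) {{nz}} , ℚ.*-inverseʳ K {{nz}} , ℚ.positive⁻¹ ((1/ K) {{nz}}) {{ℚ.1/pos⇒pos K {{ℚ.positive K>0}}}}
    where nz = ℚ.>-nonZero K>0

  pos* : ∀ {p q} → 0ℚ < p → 0ℚ < q → 0ℚ < p * q
  pos* {p} {q} p>0 q>0 = ℚ.positive⁻¹ (p * q) {{ℚ.pos*pos⇒pos p {{ℚ.positive p>0}} q {{ℚ.positive q>0}}}}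

  *-mono : ∀ {p q r s} → 0ℚ ≤ q → 0ℚ ≤ r → p ≤ q → r ≤ s → p * r ≤ q * s
  *-mono {p} {q} {r} {s} q≥0 r≥0 p≤q r≤s = ℚ.≤-trans
    (ℚ.*-monoʳ-≤-nonNeg r {{ℚ.nonNegative r≥0}} p≤q)
    (ℚ.*-monoˡ-≤-nonNeg q {{ℚ.nonNegative q≥0}} r≤s)

  abstract
    scaled : ∀ x K → 0ℚ < K →
      (∀ ε → 0ℚ < ε → ∃[ N ] (∀ m n → N ℕ.≤ m → N ℕ.≤ n → ∣ x m - x n ∣q ≤ K * ε)) →
      Cauchy x
    scaled x K K>0 h ε ε>0 with inv K K>0
    ... | K′ , KK′≡1 , K′>0 with h (K′ * ε) (pos* K′>0 ε>0)
    ... | N , g = N , λ m n N≤m N≤n → subst (∣ x m - x n ∣q ≤_) eq (g m n N≤m N≤n)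
      where
      eq : K * (K′ * ε) ≡ ε
      eq = trans (sym (ℚ.*-assoc K K′ ε)) (trans (cong (_* ε) KK′≡1) (ℚ.*-identityˡ ε))

  abstract
    const-cauchy : ∀ q → Cauchy (λ _ → q)
    const-cauchy q ε ε>0 = 0 , λ _ _ _ _ →
      subst (_≤ ε) (sym (cong ∣_∣q (ℚ.+-inverseʳ q))) (ℚ.<⇒≤ ε>0)

  2ℚ : ℚ
  2ℚ = 1ℚ + 1ℚ

  2>0 : 0ℚ < 2ℚ
  2>0 = ℚ.positive⁻¹ 2ℚ

  ε+ε : ∀ ε → ε + ε ≡ 2ℚ * ε
  ε+ε ε = sym (trans (ℚ.*-distribʳ-+ ε 1ℚ 1ℚ) (cong₂ _+_ (ℚ.*-identityˡ ε) (ℚ.*-identityˡ ε)))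

  abstract
    +-cauchy : ∀ x y → Cauchy x → Cauchy y → Cauchy (λ n → x n + y n)
    +-cauchy x y cx cy = scaled (λ n → x n + y n) 2ℚ 2>0 λ ε ε>0 →
      let (N₁ , h₁) = cx ε ε>0 ; (N₂ , h₂) = cy ε ε>0 in
      N₁ ℕ.⊔ N₂ , λ m n N≤m N≤n → begin
        ∣ (x m + y m) - (x n + y n) ∣q  ≡⟨ cong ∣_∣q (rearrange (x m) (y m) (x n) (y n)) ⟩
        ∣ (x m - x n) + (y m - y n) ∣q  ≤⟨ ℚ.∣p+q∣≤∣p∣+∣q∣ (x m - x n) (y m - y n) ⟩
        ∣ x m - x n ∣q + ∣ y m - y n ∣q ≤⟨ ℚ.+-mono-≤
          (h₁ m n (ℕ.m⊔n≤o⇒m≤o N₁ N₂ N≤m) (ℕ.m⊔n≤o⇒m≤o N₁ N₂ N≤n))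
          (h₂ m n (ℕ.m⊔n≤o⇒n≤o N₁ N₂ N≤m) (ℕ.m⊔n≤o⇒n≤o N₁ N₂ N≤n)) ⟩
        ε + ε                           ≡⟨ ε+ε ε ⟩
        2ℚ * ε                          ∎
      where
      open ℚ.≤-Reasoning
      rearrange : ∀ a b c d → (a + b) - (c + d) ≡ (a - c) + (b - d)
      rearrange = solve 4 (λ a b c d → (a :+ b) :- (c :+ d) := (a :- c) :+ (b :- d)) refl

  abstract
    neg-cauchy : ∀ x → Cauchy x → Cauchy (λ n → - x n)
    neg-cauchy x cx ε ε>0 = let (N , h) = cx ε ε>0 in
      N , λ m n N≤m N≤n → subst (_≤ ε)
        (trans (sym (ℚ.∣-p∣≡∣p∣ (x m - x n))) (cong ∣_∣q (rearrange (x m) (x n)))) (h m n N≤m N≤n)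
      where
      rearrange : ∀ a b → - (a - b) ≡ (- a) - (- b)
      rearrange = solve 2 (λ a b → :- (a :- b) := (:- a) :- (:- b)) refl

  abstract
    bounded : ∀ x → Cauchy x →
      Σ[ B ∈ ℚ ] (0ℚ < B × ∃[ N ] (∀ n → N ℕ.≤ n → ∣ x n ∣q ≤ B))
    bounded x cx with cx 1ℚ (ℚ.positive⁻¹ 1ℚ)
    ... | N , h = 1ℚ + ∣ x N ∣q
                , ℚ.+-mono-<-≤ (ℚ.positive⁻¹ 1ℚ) (ℚ.0≤∣p∣ (x N))
                , N , λ n N≤n → begin
        ∣ x n ∣q                 ≡⟨ cong ∣_∣q (rearrange (x n) (x N)) ⟩
        ∣ (x n - x N) + x N ∣q   ≤⟨ ℚ.∣p+q∣≤∣p∣+∣q∣ (x n - x N) (x N) ⟩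
        ∣ x n - x N ∣q + ∣ x N ∣q ≤⟨ ℚ.+-monoˡ-≤ ∣ x N ∣q (h n N N≤n ℕ.≤-refl) ⟩
        1ℚ + ∣ x N ∣q            ∎
      where
      open ℚ.≤-Reasoning
      rearrange : ∀ a b → a ≡ (a - b) + b
      rearrange = solve 2 (λ a b → a := (a :- b) :+ b) refl

  abstract
    *-cauchy : ∀ x y → Cauchy x → Cauchy y → Cauchy (λ n → x n * y n)
    *-cauchy x y cx cy =
      let (B₁ , B₁>0 , M₁ , b₁) = bounded x cx ; (B₂ , B₂>0 , M₂ , b₂) = bounded y cy in
      scaled (λ n → x n * y n) (B₁ + B₂) (ℚ.+-mono-< B₁>0 B₂>0) λ ε ε>0 →
      let (N₁ , h₁) = cx ε ε>0 ; (N₂ , h₂) = cy ε ε>0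
          M = M₁ ℕ.⊔ M₂ ; N = N₁ ℕ.⊔ N₂ in
      M ℕ.⊔ N , λ m n ≤m ≤n →
        let M≤m = ℕ.m⊔n≤o⇒m≤o M N ≤m ; N≤m = ℕ.m⊔n≤o⇒n≤o M N ≤m
            M≤n = ℕ.m⊔n≤o⇒m≤o M N ≤n ; N≤n = ℕ.m⊔n≤o⇒n≤o M N ≤n in begin
        ∣ x m * y m - x n * y n ∣q
          ≡⟨ cong ∣_∣q (rearrange (x m) (y m) (x n) (y n)) ⟩
        ∣ x m * (y m - y n) + y n * (x m - x n) ∣q
          ≤⟨ ℚ.∣p+q∣≤∣p∣+∣q∣ (x m * (y m - y n)) (y n * (x m - x n)) ⟩
        ∣ x m * (y m - y n) ∣q + ∣ y n * (x m - x n) ∣q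
          ≡⟨ cong₂ _+_ (ℚ.∣p*q∣≡∣p∣*∣q∣ (x m) (y m - y n)) (ℚ.∣p*q∣≡∣p∣*∣q∣ (y n) (x m - x n)) ⟩
        ∣ x m ∣q * ∣ y m - y n ∣q + ∣ y n ∣q * ∣ x m - x n ∣q
          ≤⟨ ℚ.+-mono-≤
               (*-mono (ℚ.<⇒≤ B₁>0) (ℚ.0≤∣p∣ (y m - y n))
                 (b₁ m (ℕ.m⊔n≤o⇒m≤o M₁ M₂ M≤m))
                 (h₂ m n (ℕ.m⊔n≤o⇒n≤o N₁ N₂ N≤m) (ℕ.m⊔n≤o⇒n≤o N₁ N₂ N≤n)))
               (*-mono (ℚ.<⇒≤ B₂>0) (ℚ.0≤∣p∣ (x m - x n))
                 (b₂ n (ℕ.m⊔n≤o⇒n≤o M₁ M₂ M≤n))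
                 (h₁ m n (ℕ.m⊔n≤o⇒m≤o N₁ N₂ N≤m) (ℕ.m⊔n≤o⇒m≤o N₁ N₂ N≤n))) ⟩
        B₁ * ε + B₂ * ε
          ≡⟨ sym (ℚ.*-distribʳ-+ ε B₁ B₂) ⟩
        (B₁ + B₂) * ε ∎
      where
      open ℚ.≤-Reasoning
      rearrange : ∀ a b c d → a * b - c * d ≡ a * (b - d) + d * (a - c)
      rearrange = solve 4 (λ a b c d → a :* b :- c :* d := a :* (b :- d) :+ d :* (a :- c)) refl

  ⊔-pos : ∀ {δ} → 0ℚ < δ → ∀ q → 0ℚ < δ ⊔ q
  ⊔-pos {δ} δ>0 q = ℚ.<-≤-trans δ>0 (ℚ.p≤p⊔q δ q)

  recip : ∀ δ → 0ℚ < δ → ℚ → ℚ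
  recip δ δ>0 q = (1/ (δ ⊔ q)) {{ℚ.>-nonZero (⊔-pos δ>0 q)}}

  recip-spec : ∀ δ δ>0 q → δ ≤ q → q * recip δ δ>0 q ≡ 1ℚ
  recip-spec δ δ>0 q δ≤q = trans
    (cong (_* recip δ δ>0 q) (sym (ℚ.p≤q⇒p⊔q≡q δ≤q)))
    (proj₁ (proj₂ (inv (δ ⊔ q) (⊔-pos δ>0 q))))

  recip-pos : ∀ δ δ>0 q → 0ℚ < recip δ δ>0 q
  recip-pos δ δ>0 q = proj₂ (proj₂ (inv (δ ⊔ q) (⊔-pos δ>0 q)))

  abstract
    recip-cauchy : ∀ x δ (δ>0 : 0ℚ < δ) N → (∀ n → N ℕ.≤ n → δ ≤ x n) →
      Cauchy x → Cauchy (λ n → recip δ δ>0 (x n))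
    recip-cauchy x δ δ>0 M lb cx with inv δ δ>0
    ... | D , δD≡1 , D>0 = scaled (λ n → recip δ δ>0 (x n)) (D * D) (pos* D>0 D>0) λ ε ε>0 →
      let (N , h) = cx ε ε>0 in
      M ℕ.⊔ N , λ m n ≤m ≤n →
        let M≤m = ℕ.m⊔n≤o⇒m≤o M N ≤m ; N≤m = ℕ.m⊔n≤o⇒n≤o M N ≤m
            M≤n = ℕ.m⊔n≤o⇒m≤o M N ≤n ; N≤n = ℕ.m⊔n≤o⇒n≤o M N ≤n
            rm = r (x m) ; rn = r (x n) in begin
        ∣ rm - rn ∣q
          ≡⟨ cong ∣_∣q (cong₂ _-_ (expand rm (recip-spec δ δ>0 (x n) (lb n M≤n)))
                                  (expand rn (recip-spec δ δ>0 (x m) (lb m M≤m)))) ⟩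
        ∣ rm * (x n * rn) - rn * (x m * rm) ∣q
          ≡⟨ cong ∣_∣q (rearrange rm rn (x m) (x n)) ⟩
        ∣ (rm * rn) * (x n - x m) ∣q
          ≡⟨ ℚ.∣p*q∣≡∣p∣*∣q∣ (rm * rn) (x n - x m) ⟩
        ∣ rm * rn ∣q * ∣ x n - x m ∣q
          ≡⟨ cong (_* ∣ x n - x m ∣q) (ℚ.0≤p⇒∣p∣≡p (ℚ.<⇒≤ (pos* (r>0 (x m)) (r>0 (x n))))) ⟩
        (rm * rn) * ∣ x n - x m ∣q
          ≤⟨ *-mono (ℚ.<⇒≤ (pos* D>0 D>0)) (ℚ.0≤∣p∣ (x n - x m))
               (*-mono (ℚ.<⇒≤ D>0) (ℚ.<⇒≤ (r>0 (x n))) (r≤D (x m) (lb m M≤m)) (r≤D (x n) (lb n M≤n)))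
               (h n m N≤n N≤m) ⟩
        (D * D) * ε ∎
      where
      open ℚ.≤-Reasoning
      r : ℚ → ℚ
      r = recip δ δ>0
      r>0 : ∀ q → 0ℚ < r q
      r>0 = recip-pos δ δ>0
      expand : ∀ a {b} → b ≡ 1ℚ → a ≡ a * b
      expand a eq = sym (trans (cong (a *_) eq) (ℚ.*-identityʳ a))
      rearrange : ∀ a b c d → a * (d * b) - b * (c * a) ≡ (a * b) * (d - c)
      rearrange = solve 4 (λ a b c d → a :* (d :* b) :- b :* (c :* a) := (a :* b) :* (d :- c)) refl
      r≤D : ∀ q → δ ≤ q → r q ≤ D
      r≤D q δ≤q = begin
        r q           ≡⟨ expand (r q) δD≡1 ⟩
        r q * (δ * D) ≤⟨ ℚ.*-monoˡ-≤-nonNeg (r q) {{ℚ.nonNegative (ℚ.<⇒≤ (r>0 q))}}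
                           (ℚ.*-monoʳ-≤-nonNeg D {{ℚ.nonNegative (ℚ.<⇒≤ D>0)}} δ≤q) ⟩
        r q * (q * D) ≡⟨ solve 3 (λ a b c → a :* (b :* c) := c :* (b :* a)) refl (r q) q D ⟩
        D * (q * r q) ≡⟨ sym (expand D (recip-spec δ δ>0 q δ≤q)) ⟩
        D             ∎

------------------------------------------------------------------------
-- The partial sums of the series ∑ 1/k!

1/_! : ℕ → ℚ
1/ k ! = (ℤ.+ 1 ℚ./ k !) {{k ℕ.!≢0}}

expSum : ℕ → ℚ
expSum zero    = 0ℚ
expSum (suc n) = expSum n ℚ.+ 1/ n !

module ExpLemmas where

  open CauchyLemmas
  open import Data.Rational.Base using (_+_; _*_; _-_; -_; _/_; _≤_; _<_)
  open import Data.Rational.Solver using (module +-*-Solver)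
  open +-*-Solver using (solve; _:=_; _:+_; _:*_; _:-_; :-_; con)

  1/n-pos : ∀ n .{{_ : ℕ.NonZero n}} → 0ℚ < ℤ.+ 1 / n
  1/n-pos n = ℚ.positive⁻¹ (ℤ.+ 1 / n) {{ℚ.normalize-pos 1 n}}

  1/n-anti : ∀ m n .{{_ : ℕ.NonZero m}} .{{_ : ℕ.NonZero n}} → m ℕ.≤ n → ℤ.+ 1 / n ≤ ℤ.+ 1 / m
  1/n-anti (suc m) (suc n) m≤n = ℚ.toℚᵘ-cancel-≤ (ℚᵘ.≤-respˡ-≃
    (ℚᵘ.≃-sym (ℚ.toℚᵘ-fromℚᵘ (ℚᵘ.mkℚᵘ (ℤ.+ 1) n))) (ℚᵘ.≤-respʳ-≃
    (ℚᵘ.≃-sym (ℚ.toℚᵘ-fromℚᵘ (ℚᵘ.mkℚᵘ (ℤ.+ 1) m)))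
    (ℚᵘ.*≤* (ℤ.*-monoˡ-≤-nonNeg (ℤ.+ 1) (ℤ.+≤+ m≤n)))))

  ½*1/n : ∀ n .{{_ : ℕ.NonZero n}} .{{_ : ℕ.NonZero (2 ℕ.* n)}} → ℤ.+ 1 / (2 ℕ.* n) ≡ ½ * (ℤ.+ 1 / n)
  ½*1/n (suc n) = ℚ.toℚᵘ-injective (ℚᵘ.≃-trans
    (ℚ.toℚᵘ-fromℚᵘ (ℚᵘ.mkℚᵘ (ℤ.+ 1) (n ℕ.+ 1 ℕ.* suc n)))
    (ℚᵘ.≃-sym (ℚᵘ.≃-trans (ℚ.toℚᵘ-homo-* ½ (ℤ.+ 1 / suc n))
      (ℚᵘ.*-congˡ {ℚ.toℚᵘ ½} (ℚ.toℚᵘ-fromℚᵘ (ℚᵘ.mkℚᵘ (ℤ.+ 1) n))))))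

  1/N≤ε : ∀ ε → 0ℚ < ε → ℤ.+ 1 / ℚ.↧ₙ ε ≤ ε
  1/N≤ε ε@(ℚ.mkℚ ℤ.+[1+ a ] d _) ε>0 = ℚ.toℚᵘ-cancel-≤ (ℚᵘ.≤-respˡ-≃
    (ℚᵘ.≃-sym (ℚ.toℚᵘ-fromℚᵘ (ℚᵘ.mkℚᵘ (ℤ.+ 1) d)))
    (ℚᵘ.*≤* (ℤ.*-monoʳ-≤-nonNeg (ℤ.+ suc d) {ℤ.+ 1} {ℤ.+[1+ a ]} (ℤ.+≤+ (ℕ.s≤s ℕ.z≤n)))))
  1/N≤ε (ℚ.mkℚ (ℤ.+ 0) d _) ε>0 with ℚ.positive ε>0
  ... | record { pos = () }
  1/N≤ε (ℚ.mkℚ ℤ.-[1+ _ ] d _) ε>0 with ℚ.positive ε>0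
  ... | record { pos = () }

  1/!-pos : ∀ n → 0ℚ < 1/ n !
  1/!-pos n = 1/n-pos (n !) {{n ℕ.!≢0}}

  n≤n! : ∀ n → n ℕ.≤ n !
  n≤n! zero    = ℕ.z≤n
  n≤n! (suc n) = ℕ.m≤m*n (suc n) (n !) {{n ℕ.!≢0}}

  halving : ∀ n → 1 ℕ.≤ n → 1/ suc n ! ≤ ½ * 1/ n !
  halving n 1≤n = subst (1/ suc n ! ≤_) (½*1/n (n !))
    (1/n-anti (2 ℕ.* n !) (suc n !) (ℕ.*-monoˡ-≤ (n !) (ℕ.s≤s 1≤n)))
    where instance
      _ = n ℕ.!≢0
      _ = suc n ℕ.!≢0
      _ = ℕ.m*n≢0 2 (n !)

  upper : ℕ → ℚ
  upper n = expSum n + 2ℚ * 1/ n !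

  expSum-step : ∀ n → expSum n ≤ expSum (suc n)
  expSum-step n = subst (_≤ expSum (suc n)) (ℚ.+-identityʳ (expSum n))
    (ℚ.+-monoʳ-≤ (expSum n) (ℚ.<⇒≤ (1/!-pos n)))

  upper-step : ∀ n → 1 ℕ.≤ n → upper (suc n) ≤ upper n
  upper-step n 1≤n = begin
    (s + t) + 2ℚ * 1/ suc n !   ≤⟨ ℚ.+-monoʳ-≤ (s + t) (ℚ.*-monoˡ-≤-nonNeg 2ℚ (halving n 1≤n)) ⟩
    (s + t) + 2ℚ * (½ * t)      ≡⟨ solve 2 (λ s t → (s :+ t) :+ con 2ℚ :* (con ½ :* t) := s :+ con 2ℚ :* t) refl s t ⟩
    s + 2ℚ * t                  ∎
    where
    open ℚ.≤-Reasoning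
    s = expSum n
    t = 1/ n !

  expSum-mono : ∀ {m n} → m ℕ.≤′ n → expSum m ≤ expSum n
  expSum-mono (ℕ.≤′-reflexive refl) = ℚ.≤-refl
  expSum-mono (ℕ.≤′-step {n} m≤n)   = ℚ.≤-trans (expSum-mono m≤n) (expSum-step n)

  upper-anti : ∀ {m n} → 1 ℕ.≤ m → m ℕ.≤′ n → upper n ≤ upper m
  upper-anti 1≤m (ℕ.≤′-reflexive refl) = ℚ.≤-refl
  upper-anti 1≤m (ℕ.≤′-step {n} m≤n)   =
    ℚ.≤-trans (upper-step n (ℕ.≤-trans 1≤m (ℕ.≤′⇒≤ m≤n))) (upper-anti 1≤m m≤n)

  expSum≤upper : ∀ n → expSum n ≤ upper n
  expSum≤upper n = subst (_≤ upper n) (ℚ.+-identityʳ (expSum n))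
    (ℚ.+-monoʳ-≤ (expSum n) (ℚ.<⇒≤ (pos* 2>0 (1/!-pos n))))

  minus-≤ : ∀ {a b c} → a ≤ c + b → a - b ≤ c
  minus-≤ {a} {b} {c} h = subst (a - b ≤_)
    (solve 2 (λ c b → (c :+ b) :- b := c) refl c b) (ℚ.+-monoˡ-≤ (- b) h)

  ∣-∣≤ : ∀ {a b c} → a ≤ c + b → b ≤ c + a → ∣ a - b ∣q ≤ c
  ∣-∣≤ {a} {b} {c} a≤ b≤ with ℚ.∣p∣≡p∨∣p∣≡-p (a - b)
  ... | inj₁ eq = subst (_≤ c) (sym eq) (minus-≤ a≤)
  ... | inj₂ eq = subst (_≤ c) (sym (trans eq (solve 2 (λ a b → :- (a :- b) := b :- a) refl a b))) (minus-≤ b≤)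

  abstract
    expSum-cauchy : Cauchy expSum
    expSum-cauchy = scaled expSum 2ℚ 2>0 λ ε ε>0 →
      let N = ℚ.↧ₙ ε
          1≤N = ℕ.s≤s ℕ.z≤n
          t≤ε : 1/ N ! ≤ ε
          t≤ε = ℚ.≤-trans (1/n-anti N (N !) {{_}} {{N ℕ.!≢0}} (n≤n! N)) (1/N≤ε ε ε>0)
          close : ∀ m n → N ℕ.≤ m → N ℕ.≤ n → expSum m ≤ 2ℚ * ε + expSum n
          close m n N≤m N≤n = begin
            expSum m              ≤⟨ expSum≤upper m ⟩
            upper m               ≤⟨ upper-anti 1≤N (ℕ.≤⇒≤′ N≤m) ⟩
            expSum N + 2ℚ * 1/ N ! ≤⟨ ℚ.+-mono-≤ (expSum-mono (ℕ.≤⇒≤′ N≤n)) (ℚ.*-monoˡ-≤-nonNeg 2ℚ t≤ε) ⟩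
            expSum n + 2ℚ * ε     ≡⟨ ℚ.+-comm (expSum n) (2ℚ * ε) ⟩
            2ℚ * ε + expSum n     ∎
      in N , λ m n N≤m N≤n → ∣-∣≤ (close m n N≤m N≤n) (close n m N≤n N≤m)
      where open ℚ.≤-Reasoning

  1≤expSum : ∀ n → 1 ℕ.≤ n → 1ℚ ≤ expSum n
  1≤expSum n 1≤n = ℚ.≤-trans (ℚ.≤-reflexive 1≡) (expSum-mono {1} {n} (ℕ.≤⇒≤′ 1≤n))
    where
    1≡ : 1ℚ ≡ expSum 1
    1≡ = sym (ℚ.+-identityˡ 1ℚ)

------------------------------------------------------------------------
-- Real numbers as Cauchy sequences of rationals; equality is the setoid
-- relation _≃_.

record ℝ : Set where
  constructor mkℝ
  field
    seq    : ℕ → ℚ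
    cauchy : Cauchy seq

open ℝ public

infix  4 _≤_ _<_ _≃_
infixl 6 _+_ _-_
infixl 7 _*_
infix  8 -_

record _≤_ (x y : ℝ) : Set where
  constructor *≤*
  field
    bound : ∀ ε → 0ℚ ℚ.< ε → ∃[ N ] (∀ n → N ℕ.≤ n → seq x n ℚ.≤ seq y n ℚ.+ ε)

_≃_ : ℝ → ℝ → Set
x ≃ y = x ≤ y × y ≤ x

record _<_ (x y : ℝ) : Set where
  constructor *<*
  field
    gap   : ℚ
    gap>0 : 0ℚ ℚ.< gap
    bound : ∃[ N ] (∀ n → N ℕ.≤ n → seq x n ℚ.+ gap ℚ.≤ seq y n)

fromℚ : ℚ → ℝ
fromℚ q = mkℝ (λ _ → q) (CauchyLemmas.const-cauchy q)

fromℕ : ℕ → ℝ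
fromℕ k = fromℚ (ℤ.+ k ℚ./ 1)

0ℝ 1ℝ : ℝ
0ℝ = fromℚ 0ℚ
1ℝ = fromℚ 1ℚ

_+_ : ℝ → ℝ → ℝ
x + y = mkℝ (λ n → seq x n ℚ.+ seq y n) (CauchyLemmas.+-cauchy (seq x) (seq y) (cauchy x) (cauchy y))

_*_ : ℝ → ℝ → ℝ
x * y = mkℝ (λ n → seq x n ℚ.* seq y n) (CauchyLemmas.*-cauchy (seq x) (seq y) (cauchy x) (cauchy y))

-_ : ℝ → ℝ
-_ x = mkℝ (λ n → ℚ.- seq x n) (CauchyLemmas.neg-cauchy (seq x) (cauchy x))

_-_ : ℝ → ℝ → ℝ
x - y = x + (- y)

-- The terms are 1 / (δ ⊔ xₙ), where the witness of 0 < x provides a rational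
-- δ > 0 with δ ≤ xₙ eventually.
recip : (x : ℝ) → 0ℝ < x → ℝ
recip x (*<* δ δ>0 (N , lb)) = mkℝ (λ n → CauchyLemmas.recip δ δ>0 (seq x n))
  (CauchyLemmas.recip-cauchy (seq x) δ δ>0 N
    (λ n N≤n → subst (ℚ._≤ seq x n) (ℚ.+-identityˡ δ) (lb n N≤n)) (cauchy x))

recip-inverse : ∀ x (x>0 : 0ℝ < x) → x * recip x x>0 ≃ 1ℝ
recip-inverse x (*<* δ δ>0 (N , lb)) =
    *≤* (λ ε ε>0 → N , λ n N≤n → ℚ.≤-trans (ℚ.≤-reflexive (eq n N≤n)) (1≤1+ ε ε>0))
  , *≤* (λ ε ε>0 → N , λ n N≤n → ℚ.≤-trans (1≤1+ ε ε>0) (ℚ.≤-reflexive (cong (ℚ._+ ε) (sym (eq n N≤n)))))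
  where
  eq : ∀ n → N ℕ.≤ n → seq x n ℚ.* CauchyLemmas.recip δ δ>0 (seq x n) ≡ 1ℚ
  eq n N≤n = CauchyLemmas.recip-spec δ δ>0 (seq x n)
    (subst (ℚ._≤ seq x n) (ℚ.+-identityˡ δ) (lb n N≤n))
  1≤1+ : ∀ ε → 0ℚ ℚ.< ε → 1ℚ ℚ.≤ 1ℚ ℚ.+ ε
  1≤1+ ε ε>0 = ℚ.+-monoʳ-≤ 1ℚ (ℚ.<⇒≤ ε>0)

e : ℝ
e = mkℝ expSum ExpLemmas.expSum-cauchy

e>0 : 0ℝ < e
e>0 = *<* 1ℚ (ℚ.positive⁻¹ 1ℚ) (1 , ExpLemmas.1≤expSum)

e⁻¹ : ℝ
e⁻¹ = recip e e>0

∑ : {A : Set} → List A → (A → ℝ) → ℝ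
∑ as g = foldr (λ a s → g a + s) 0ℝ as

infix 5 ∑
syntax ∑ as (λ a → g) = ∑[ a ∈ as ] g

-- Floors and ceilings of non-negative reals are given by relations, since they
-- are not computable functions of a Cauchy sequence.

IsFloor : ℝ → ℕ → Set
IsFloor x k = fromℕ k ≤ x × x < fromℕ (suc k)

IsCeiling : ℝ → ℕ → Set
IsCeiling x k = x ≤ fromℕ k × fromℕ k < x + 1ℝ

------------------------------------------------------------------------
-- Set functions on the ground set Fin n

module _ {n : ℕ} where

  Nonnegative : (Subset n → ℝ) → Set
  Nonnegative f = ∀ S → 0ℝ ≤ f S

  Monotone : (Subset n → ℝ) → Set
  Monotone f = ∀ S T → S ⊆ T → f S ≤ f T

  Submodular : (Subset n → ℝ) → Set
  Submodular f = ∀ S T v → S ⊆ T → v ∉ T →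
    f (T ∪ ⁅ v ⁆) - f T ≤ f (S ∪ ⁅ v ⁆) - f S

  record IsPartition {m : ℕ} (V : Fin m → Subset n) : Set where
    field
      disjoint : ∀ s t → s ≢ t → Empty (V s ∩ V t)
      covers   : ∀ v → ∃[ t ] v ∈ V t

subsets : ∀ n → List (Subset n)
subsets zero    = [ Vec.[] ]
subsets (suc n) = map (inside Vec.∷_) (subsets n) ++ map (outside Vec.∷_) (subsets n)

-- Each subset of size at most b occurs exactly once.
𝓕 : ∀ {n} → ℕ → List (Subset n)
𝓕 {n} b = filter (λ S → ∣ S ∣ ℕ.≤? b) (subsets n)

------------------------------------------------------------------------
-- Problem P.0.  A solution assigns a weight to every subset of Fin n, but only
-- the weights of the sets in 𝓕 enter the constraints and the objective.

module P0 {n m : ℕ} (f : Subset n → ℝ) (V : Fin m → Subset n) (α β : Fin m → ℝ) (b : ℕ) where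

  objective : (Subset n → ℝ) → ℝ
  objective x = ∑[ S ∈ 𝓕 b ] x S * f S

  record IsFeasible (x : Subset n → ℝ) : Set where
    field
      in-[0,1] : ∀ S → ∣ S ∣ ℕ.≤ b → 0ℝ ≤ x S × x S ≤ 1ℝ
      lower    : ∀ t → α t ≤ (∑[ S ∈ 𝓕 b ] x S * fromℕ ∣ S ∩ V t ∣)
      upper    : ∀ t → (∑[ S ∈ 𝓕 b ] x S * fromℕ ∣ S ∩ V t ∣) ≤ β t
      total    : (∑[ S ∈ 𝓕 b ] x S) ≤ 1ℝ

  IsOptimalSolution : (Subset n → ℝ) → Set
  IsOptimalSolution x = IsFeasible x × (∀ y → IsFeasible y → objective y ≤ objective x)

  IsOptimalValue : ℝ → Set
  IsOptimalValue OPT = ∃[ x ] (IsOptimalSolution x × objective x ≃ OPT)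

------------------------------------------------------------------------
-- The family 𝓘, with lo t = ⌊α t⌋ and hi t = ⌈β t⌉

𝓘 : ∀ {n m} → (Fin m → Subset n) → (lo hi : Fin m → ℕ) → ℕ → Subset n → Set
𝓘 V lo hi b S =
    (∀ t → ∣ S ∩ V t ∣ ℕ.≤ hi t)
  × sumℕ (λ t → lo t ℕ.⊔ ∣ S ∩ V t ∣) ℕ.≤ b

------------------------------------------------------------------------
-- The greedy algorithm for f on a family I of subsets

module Greedy {n : ℕ} (f : Subset n → ℝ) (I : Subset n → Set) where

  Addable : Subset n → Fin n → Set
  Addable S v = v ∉ S × I (S ∪ ⁅ v ⁆)

  Step : Subset n → Subset n → Set
  Step S S′ = ∃[ v ] (Addable S v
    × (∀ w → Addable S w → f (S ∪ ⁅ w ⁆) - f S ≤ f (S ∪ ⁅ v ⁆) - f S)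
    × S′ ≡ S ∪ ⁅ v ⁆)

  IsOutput : Subset n → Set
  IsOutput A = Star Step ∅ A × ¬ (∃[ v ] Addable A v)

{-# OPTIONS --safe #-}

-- The greedy output A satisfies OPT ≤ 2 f(A), which suffices because
-- (1 - 1/e)² ≤ 1. Let x be an optimal solution of P.0 and y_v = ∑_{S ∋ v} x_S.
-- Submodularity gives f(S) ≤ f(A) + ∑_{v ∈ S} f(v | A) for each S, hence
-- OPT ≤ f(A) + ∑_v y_v f(v | A), and it remains to bound the last sum by f(A).
-- Call v blocked at S ∈ 𝓘 if it cannot be added to S. The constraints of P.0
-- imply the rank inequality y(blocked S) ≤ |S|. Since an element v that becomes
-- blocked when the greedy algorithm adds a has f(v | A) ≤ the gain of a, and
-- these gains decrease, the rank inequalities bound ∑_v y_v f(v | A) by the sum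
-- of all greedy gains, as in the proof that greedy is ½-optimal on a matroid.

module Submission where

open import Algebra.Bundles using (CommutativeRing)
open import Algebra.Structures using (IsCommutativeRing)
open import Data.Bool.Base using (Bool; true; false; if_then_else_)
open import Data.Fin.Base using (Fin; zero; suc)
import Data.Fin.Properties as Fin
open import Data.Fin.Subset
  using (Subset; inside; outside; _∈_; _∉_; _⊆_; _∩_; _∪_; ⁅_⁆; ∣_∣; ⊤) renaming (⊥ to ∅)
open import Data.Fin.Subset.Properties
import Data.Integer.Base as ℤ
import Data.Integer.Properties as ℤ
open import Data.List.Base using (List; []; _∷_; foldr)
import Data.List.Membership.Propositional as List
open import Data.List.Membership.Propositional.Properties using (∈-filter⁻)
open import Data.List.Relation.Unary.Any using (here; there)
open import Data.Nat.Base as ℕ using (ℕ; NonZero)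
import Data.Nat.Properties as ℕ
open import Data.Product.Base using (Σ-syntax; ∃-syntax; _×_; _,_; proj₁; proj₂)
open import Data.Rational.Base as ℚ using (ℚ; 0ℚ; 1ℚ; ½)
import Data.Rational.Properties as ℚ
open import Data.Rational.Solver using (module +-*-Solver)
import Data.Rational.Unnormalised.Base as ℚᵘ
import Data.Rational.Unnormalised.Properties as ℚᵘ
open import Data.Sum.Base using (inj₁; inj₂; [_,_])
open import Data.Vec.Base as Vec using (lookup; tabulate)
open import Data.Vec.Properties using ([]=⇒lookup; lookup⇒[]=; lookup∘tabulate)
open import Function.Base using (_∘_; id)
open import Level using (0ℓ)
open import Relation.Binary.Bundles using (Poset)
open import Relation.Binary.Construct.Closure.ReflexiveTransitive as Star using (Star; _◅_)
open import Relation.Binary.PropositionalEquality as ≡ using (_≡_; _≢_; subst; cong)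
open import Relation.Binary.Structures using (IsEquivalence; IsPartialOrder)
open import Relation.Nullary using (¬_; Dec; yes; no; does; contradiction; ¬?; _×-dec_)
open import Relation.Nullary.Decidable using (dec-true; dec-false)

open import Algebra.Properties.CommutativeMonoid.Sum ℕ.+-0-commutativeMonoid
  using () renaming (sum to sumℕ)

open import Defs using (IsPartition; 𝓘)
open IsPartition

-- Sizes of subsets and blocked elements

sumℕ-mono : ∀ {m} {f g : Fin m → ℕ} → (∀ i → f i ℕ.≤ g i) → sumℕ f ℕ.≤ sumℕ g
sumℕ-mono {ℕ.zero}  f≤g = ℕ.z≤n
sumℕ-mono {ℕ.suc m} f≤g = ℕ.+-mono-≤ (f≤g zero) (sumℕ-mono (f≤g ∘ suc))

-- Made for adding one element to a set: only the count of its own group `t` can grow, and by at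
-- most one.
sumℕ-bump : ∀ {m} {f g : Fin m → ℕ} t → (∀ s → s ≢ t → f s ℕ.≤ g s) → f t ℕ.≤ ℕ.suc (g t) →
  sumℕ f ℕ.≤ ℕ.suc (sumℕ g)
sumℕ-bump zero    f≤g ft≤ = ℕ.+-mono-≤ ft≤ (sumℕ-mono λ i → f≤g (suc i) λ ())
sumℕ-bump {f = f} {g} (suc t) f≤g ft≤ = ℕ.≤-trans
  (ℕ.+-mono-≤ (f≤g zero λ ()) (sumℕ-bump t (λ s s≢t → f≤g (suc s) (s≢t ∘ Fin.suc-injective)) ft≤))
  (ℕ.≤-reflexive (ℕ.+-suc (g zero) (sumℕ (g ∘ suc))))

∣p∪⁅v⁆∣≤1+∣p∣ : ∀ {n} (p : Subset n) v → ∣ p ∪ ⁅ v ⁆ ∣ ℕ.≤ ℕ.suc ∣ p ∣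
∣p∪⁅v⁆∣≤1+∣p∣ (inside  Vec.∷ p) zero    = ℕ.s≤s (ℕ.m≤n⇒m≤1+n (ℕ.≤-reflexive (cong ∣_∣ (∪-identityʳ p))))
∣p∪⁅v⁆∣≤1+∣p∣ (outside Vec.∷ p) zero    = ℕ.s≤s (ℕ.≤-reflexive (cong ∣_∣ (∪-identityʳ p)))
∣p∪⁅v⁆∣≤1+∣p∣ (inside  Vec.∷ p) (suc v) = ℕ.s≤s (∣p∪⁅v⁆∣≤1+∣p∣ p v)
∣p∪⁅v⁆∣≤1+∣p∣ (outside Vec.∷ p) (suc v) = ∣p∪⁅v⁆∣≤1+∣p∣ p v

∪-monoˡ : ∀ {n} {p q : Subset n} r → p ⊆ q → p ∪ r ⊆ q ∪ r
∪-monoˡ {p = p} r p⊆q = x∈p∪q⁺ ∘ [ inj₁ ∘ p⊆q , inj₂ ] ∘ x∈p∪q⁻ p r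

∩-monoˡ : ∀ {n} {p q : Subset n} r → p ⊆ q → p ∩ r ⊆ q ∩ r
∩-monoˡ {p = p} r p⊆q x∈ = let (x∈p , x∈r) = x∈p∩q⁻ p r x∈ in x∈p∩q⁺ (p⊆q x∈p , x∈r)

-- What `Greedy.Addable` unfolds to, restated free of the set function so that the combinatorics
-- works over any ordered ring.
Addable : ∀ {n} → (Subset n → Set) → Subset n → Fin n → Set
Addable I S v = v ∉ S × I (S ∪ ⁅ v ⁆)

module Blocked {n : ℕ} (I : Subset n → Set) (I? : ∀ S → Dec (I S)) where

  addable? : ∀ S v → Dec (Addable I S v)
  addable? S v = ¬? (v ∈? S) ×-dec I? (S ∪ ⁅ v ⁆)

  -- The elements of `S` itself are included, since an addable element has to lie outside `S`.
  blocked : Subset n → Subset n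
  blocked S = tabulate λ v → does (¬? (addable? S v))

  ∈-blocked⁺ : ∀ {S v} → ¬ Addable I S v → v ∈ blocked S
  ∈-blocked⁺ {S} {v} ¬a = lookup⇒[]= v (blocked S)
    (≡.trans (lookup∘tabulate _ v) (dec-true (¬? (addable? S v)) ¬a))

  ∈-blocked⁻ : ∀ {S v} → v ∈ blocked S → ¬ Addable I S v
  ∈-blocked⁻ {S} {v} v∈ a = contradiction
    (≡.trans (≡.sym ([]=⇒lookup v∈)) (≡.trans (lookup∘tabulate _ v)
      (dec-false (¬? (addable? S v)) (λ ¬a → ¬a a)))) λ ()

  ∉-blocked : ∀ {S v} → v ∉ blocked S → Addable I S v
  ∉-blocked {S} {v} v∉ with addable? S v
  ... | yes a = a
  ... | no ¬a = contradiction (∈-blocked⁺ ¬a) v∉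

-- Sums in an ordered commutative ring

-- The structure that the counting arguments work in. The order is partial, as Cauchy reals cannot
-- be compared constructively, and `fromℕ` is a field so that the reals can supply the embedding
-- that occurs in P.0.
record OrderedRing : Set₁ where
  infix 4 _≤_
  field
    commutativeRing : CommutativeRing 0ℓ 0ℓ
  open CommutativeRing commutativeRing public hiding (zero)
  field
    _≤_            : Carrier → Carrier → Set
    isPartialOrder : IsPartialOrder _≈_ _≤_
    +-mono-≤       : ∀ {x y u v} → x ≤ y → u ≤ v → x + u ≤ y + v
    *-nonneg       : ∀ {x y} → 0# ≤ x → 0# ≤ y → 0# ≤ x * y
    0≤1            : 0# ≤ 1#
    1≰0            : ¬ (1# ≤ 0#)
    fromℕ          : ℕ → Carrier
    fromℕ-zero     : fromℕ ℕ.zero ≈ 0#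
    fromℕ-suc      : ∀ k → fromℕ (ℕ.suc k) ≈ 1# + fromℕ k

module OrderedRingProperties (R : OrderedRing) where

  open OrderedRing R
  open IsPartialOrder isPartialOrder public using ()
    renaming (reflexive to ≤-reflexive; trans to ≤-trans; refl to ≤-refl)
  open import Algebra.Properties.Semiring.Sum semiring
    using (sum; sum-cong-≋; ∑-comm; sum-replicate-zero)
  open import Algebra.Solver.Ring.NaturalCoefficients.Default commutativeSemiring
    using (solve; _:=_; _:+_)

  poset : Poset _ _ _
  poset = record { isPartialOrder = isPartialOrder }

  open import Relation.Binary.Reasoning.PartialOrder poset

  x+[y-x]≈y : ∀ x y → x + (y - x) ≈ y
  x+[y-x]≈y x y = begin-equality
    x + (y - x)     ≈⟨ solve 3 (λ x y z → x :+ (y :+ z) := y :+ (x :+ z)) refl x y (- x) ⟩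
    y + (x - x)     ≈⟨ +-congˡ (-‿inverseʳ x) ⟩
    y + 0#          ≈⟨ +-identityʳ y ⟩
    y               ∎

  +-cancelʳ-≤ : ∀ {x y} z → x + z ≤ y + z → x ≤ y
  +-cancelʳ-≤ {x} {y} z h = begin
    x           ≈⟨ shift x ⟨
    x + z - z   ≤⟨ +-mono-≤ h ≤-refl ⟩
    y + z - z   ≈⟨ shift y ⟩
    y           ∎
    where
    shift : ∀ x → x + z - z ≈ x
    shift x = trans (+-assoc x z (- z)) (trans (+-congˡ (-‿inverseʳ z)) (+-identityʳ x))

  x≤y⇒0≤y-x : ∀ {x y} → x ≤ y → 0# ≤ y - x
  x≤y⇒0≤y-x {x} {y} x≤y = begin
    0#     ≈⟨ -‿inverseʳ x ⟨
    x - x  ≤⟨ +-mono-≤ x≤y ≤-refl ⟩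
    y - x  ∎

  x≤y+x : ∀ {x y} → 0# ≤ y → x ≤ y + x
  x≤y+x {x} {y} 0≤y = begin
    x       ≈⟨ +-identityˡ x ⟨
    0# + x  ≤⟨ +-mono-≤ 0≤y ≤-refl ⟩
    y + x   ∎

  -- The axioms order only products of non-negative elements, so they are applied to `c` and
  -- `y - x`.
  *-monoʳ-≤ : ∀ {c x y} → 0# ≤ c → x ≤ y → c * x ≤ c * y
  *-monoʳ-≤ {c} {x} {y} 0≤c x≤y = begin
    c * x                  ≤⟨ x≤y+x (*-nonneg 0≤c (x≤y⇒0≤y-x x≤y)) ⟩
    c * (y - x) + c * x    ≈⟨ distribˡ c (y - x) x ⟨
    c * (y - x + x)        ≈⟨ *-congˡ (trans (+-comm (y - x) x) (x+[y-x]≈y x y)) ⟩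
    c * y                  ∎

  *-monoˡ-≤ : ∀ {c x y} → 0# ≤ c → x ≤ y → x * c ≤ y * c
  *-monoˡ-≤ {c} {x} {y} 0≤c x≤y = begin
    x * c ≈⟨ *-comm x c ⟩
    c * x ≤⟨ *-monoʳ-≤ 0≤c x≤y ⟩
    c * y ≈⟨ *-comm c y ⟩
    y * c ∎

  fromℕ-nonneg : ∀ k → 0# ≤ fromℕ k
  fromℕ-nonneg ℕ.zero    = ≤-reflexive (sym fromℕ-zero)
  fromℕ-nonneg (ℕ.suc k) = begin
    0#            ≤⟨ fromℕ-nonneg k ⟩
    fromℕ k       ≤⟨ x≤y+x 0≤1 ⟩
    1# + fromℕ k  ≈⟨ fromℕ-suc k ⟨
    fromℕ (ℕ.suc k) ∎

  fromℕ-mono : ∀ {j k} → j ℕ.≤ k → fromℕ j ≤ fromℕ k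
  fromℕ-mono {k = k} ℕ.z≤n = ≤-trans (≤-reflexive fromℕ-zero) (fromℕ-nonneg k)
  fromℕ-mono (ℕ.s≤s {j} {k} j≤k) = begin
    fromℕ (ℕ.suc j)  ≈⟨ fromℕ-suc j ⟩
    1# + fromℕ j     ≤⟨ +-mono-≤ ≤-refl (fromℕ-mono j≤k) ⟩
    1# + fromℕ k     ≈⟨ fromℕ-suc k ⟨
    fromℕ (ℕ.suc k)  ∎

  -- Brings integer facts back from inequalities that pass through fractional weights. Recursion on
  -- the naturals avoids deciding the order of the ring; `1≰0` rules out the one impossible case.
  fromℕ-cancel-≤ : ∀ {j k} → fromℕ j ≤ fromℕ k → j ℕ.≤ k
  fromℕ-cancel-≤ {ℕ.zero}  {k}       h = ℕ.z≤n
  fromℕ-cancel-≤ {ℕ.suc j} {ℕ.zero}  h = contradiction (begin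
    1#               ≤⟨ x≤y+x (fromℕ-nonneg j) ⟩
    fromℕ j + 1#     ≈⟨ trans (+-comm (fromℕ j) 1#) (sym (fromℕ-suc j)) ⟩
    fromℕ (ℕ.suc j)  ≤⟨ h ⟩
    fromℕ ℕ.zero     ≈⟨ fromℕ-zero ⟩
    0#               ∎) 1≰0
  fromℕ-cancel-≤ {ℕ.suc j} {ℕ.suc k} h = ℕ.s≤s (fromℕ-cancel-≤ (+-cancelʳ-≤ 1# (begin
    fromℕ j + 1#     ≈⟨ trans (+-comm (fromℕ j) 1#) (sym (fromℕ-suc j)) ⟩
    fromℕ (ℕ.suc j)  ≤⟨ h ⟩
    fromℕ (ℕ.suc k)  ≈⟨ trans (fromℕ-suc k) (+-comm 1# (fromℕ k)) ⟩
    fromℕ k + 1#     ∎)))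

  fromℕ-+ : ∀ j k → fromℕ (j ℕ.+ k) ≈ fromℕ j + fromℕ k
  fromℕ-+ ℕ.zero    k = sym (trans (+-congʳ fromℕ-zero) (+-identityˡ (fromℕ k)))
  fromℕ-+ (ℕ.suc j) k = begin-equality
    fromℕ (ℕ.suc (j ℕ.+ k))    ≈⟨ fromℕ-suc (j ℕ.+ k) ⟩
    1# + fromℕ (j ℕ.+ k)       ≈⟨ +-congˡ (fromℕ-+ j k) ⟩
    1# + (fromℕ j + fromℕ k)   ≈⟨ +-assoc 1# (fromℕ j) (fromℕ k) ⟨
    1# + fromℕ j + fromℕ k     ≈⟨ +-congʳ (fromℕ-suc j) ⟨
    fromℕ (ℕ.suc j) + fromℕ k  ∎

  fromℕ-sum : ∀ {m} (k : Fin m → ℕ) → fromℕ (sumℕ k) ≈ sum (fromℕ ∘ k)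
  fromℕ-sum {ℕ.zero}  k = fromℕ-zero
  fromℕ-sum {ℕ.suc m} k = trans (fromℕ-+ (k zero) _) (+-congˡ (fromℕ-sum (k ∘ suc)))

  sum-mono : ∀ {m} {f g : Fin m → Carrier} → (∀ i → f i ≤ g i) → sum f ≤ sum g
  sum-mono {ℕ.zero}  f≤g = ≤-refl
  sum-mono {ℕ.suc m} f≤g = +-mono-≤ (f≤g zero) (sum-mono (f≤g ∘ suc))

  sum-point : ∀ {m} (g : Fin m → Carrier) t → (∀ s → s ≢ t → g s ≈ 0#) → sum g ≈ g t
  sum-point {ℕ.suc m} g zero    g≈0 = trans
    (+-congˡ (trans (sum-cong-≋ λ s → g≈0 (suc s) λ ()) (sum-replicate-zero m))) (+-identityʳ (g zero))
  sum-point {ℕ.suc m} g (suc t) g≈0 = trans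
    (+-cong (g≈0 zero λ ()) (sum-point (g ∘ suc) t λ s s≢t → g≈0 (suc s) (s≢t ∘ Fin.suc-injective)))
    (+-identityˡ (g (suc t)))

  indicator : Bool → Carrier
  indicator true  = 1#
  indicator false = 0#

  χ : ∀ {n} → Subset n → Fin n → Carrier
  χ S v = indicator (lookup S v)

  χ-nonneg : ∀ {n} (S : Subset n) v → 0# ≤ χ S v
  χ-nonneg S v with lookup S v
  ... | true  = 0≤1
  ... | false = ≤-refl

  χ≤1 : ∀ {n} (S : Subset n) v → χ S v ≤ 1#
  χ≤1 S v with lookup S v
  ... | true  = ≤-refl
  ... | false = 0≤1

  χ-∈ : ∀ {n} {S : Subset n} {v} → v ∈ S → χ S v ≈ 1#
  χ-∈ v∈S = reflexive (cong indicator ([]=⇒lookup v∈S))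

  ∉⇒lookup : ∀ {n} {S : Subset n} {v} → v ∉ S → lookup S v ≡ outside
  ∉⇒lookup {S = S} {v} v∉S with lookup S v in eq
  ... | true  = contradiction (lookup⇒[]= v S eq) v∉S
  ... | false = ≡.refl

  χ-∉ : ∀ {n} {S : Subset n} {v} → v ∉ S → χ S v ≈ 0#
  χ-∉ v∉S = reflexive (cong indicator (∉⇒lookup v∉S))

  fromℕ-∣∣ : ∀ {n} (S : Subset n) → fromℕ ∣ S ∣ ≈ sum (χ S)
  fromℕ-∣∣ Vec.[]              = fromℕ-zero
  fromℕ-∣∣ (inside  Vec.∷ S) = trans (fromℕ-suc ∣ S ∣) (+-congˡ (fromℕ-∣∣ S))
  fromℕ-∣∣ (outside Vec.∷ S) = trans (fromℕ-∣∣ S) (sym (+-identityˡ (sum (χ S))))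

  -- The mass y(S). The indicator factor lets the sum range over the whole ground set, so that it
  -- can be exchanged with sums over groups or over sets.
  weight : ∀ {n} → (Fin n → Carrier) → Subset n → Carrier
  weight y S = sum λ v → χ S v * y v

  weight-1 : ∀ {n} (S : Subset n) → weight (λ _ → 1#) S ≈ fromℕ ∣ S ∣
  weight-1 S = trans (sum-cong-≋ λ v → *-identityʳ (χ S v)) (sym (fromℕ-∣∣ S))

  weight≤∣∣ : ∀ {n} {y : Fin n → Carrier} S → (∀ v → y v ≤ 1#) → weight y S ≤ fromℕ ∣ S ∣
  weight≤∣∣ S y≤1 = ≤-trans (sum-mono λ v → *-monoʳ-≤ (χ-nonneg S v) (y≤1 v)) (≤-reflexive (weight-1 S))

  weight-mono : ∀ {n} {y : Fin n → Carrier} {S T} → (∀ v → 0# ≤ y v) → S ⊆ T → weight y S ≤ weight y T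
  weight-mono {y = y} {S} {T} 0≤y S⊆T = sum-mono λ v → *-monoˡ-≤ (0≤y v) (χ-mono v)
    where
    χ-mono : ∀ v → χ S v ≤ χ T v
    χ-mono v with v ∈? S
    ... | yes v∈S = ≤-reflexive (trans (χ-∈ v∈S) (sym (χ-∈ (S⊆T v∈S))))
    ... | no  v∉S = ≤-trans (≤-reflexive (χ-∉ v∉S)) (χ-nonneg T v)

  -- After the sums are exchanged, each `v` meets exactly one group, so a single term of the inner
  -- sum survives.
  weight-partition : ∀ {n m} {V : Fin m → Subset n} → IsPartition V → ∀ y C →
    sum (λ t → weight y (C ∩ V t)) ≈ weight y C
  weight-partition {V = V} isPartition y C = trans
    (∑-comm λ t v → χ (C ∩ V t) v * y v) (sum-cong-≋ pointwise)
    where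
    pointwise : ∀ v → sum (λ t → χ (C ∩ V t) v * y v) ≈ χ C v * y v
    pointwise v with covers isPartition v
    ... | t , v∈Vt = trans (sum-point (λ t → χ (C ∩ V t) v * y v) t other) (*-congʳ same)
      where
      other : ∀ s → s ≢ t → χ (C ∩ V s) v * y v ≈ 0#
      other s s≢t = trans (*-congʳ (χ-∉ λ v∈ →
        disjoint isPartition s t s≢t (v , x∈p∩q⁺ (p∩q⊆q C (V s) v∈ , v∈Vt)))) (zeroˡ (y v))
      same : χ (C ∩ V t) v ≈ χ C v
      same with v ∈? C
      ... | yes v∈C = trans (χ-∈ (x∈p∩q⁺ (v∈C , v∈Vt))) (sym (χ-∈ v∈C))
      ... | no  v∉C = trans (χ-∉ (v∉C ∘ p∩q⊆p C (V t))) (sym (χ-∉ v∉C))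

  -- Counting is weighing with all weights 1, so this is `weight-partition` carried back to the
  -- naturals.
  ∣∣-partition : ∀ {n m} {V : Fin m → Subset n} → IsPartition V → ∀ S →
    sumℕ (λ t → ∣ S ∩ V t ∣) ≡ ∣ S ∣
  ∣∣-partition {V = V} isPartition S = ℕ.≤-antisym
    (fromℕ-cancel-≤ (≤-reflexive eq)) (fromℕ-cancel-≤ (≤-reflexive (sym eq)))
    where
    eq : fromℕ (sumℕ λ t → ∣ S ∩ V t ∣) ≈ fromℕ ∣ S ∣
    eq = begin-equality
      fromℕ (sumℕ λ t → ∣ S ∩ V t ∣)            ≈⟨ fromℕ-sum (λ t → ∣ S ∩ V t ∣) ⟩
      sum (λ t → fromℕ ∣ S ∩ V t ∣)             ≈⟨ sum-cong-≋ (λ t → weight-1 (S ∩ V t)) ⟨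
      sum (λ t → weight (λ _ → 1#) (S ∩ V t))   ≈⟨ weight-partition isPartition (λ _ → 1#) S ⟩
      weight (λ _ → 1#) S                       ≈⟨ weight-1 S ⟩
      fromℕ ∣ S ∣                               ∎

-- The family 𝓘 and its rank inequality

𝓘? : ∀ {n m} (V : Fin m → Subset n) lo hi b S → Dec (𝓘 V lo hi b S)
𝓘? V lo hi b S = Fin.all? (λ t → ∣ S ∩ V t ∣ ℕ.≤? hi t) ×-dec sumℕ (λ t → lo t ℕ.⊔ ∣ S ∩ V t ∣) ℕ.≤? b

𝓘-downward : ∀ {n m} {V : Fin m → Subset n} {lo hi b S T} → S ⊆ T → 𝓘 V lo hi b T → 𝓘 V lo hi b S
𝓘-downward {V = V} {lo} S⊆T (≤hi , ≤b) =
    (λ t → ℕ.≤-trans (p⊆q⇒∣p∣≤∣q∣ (∩-monoˡ (V t) S⊆T)) (≤hi t))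
  , ℕ.≤-trans (sumℕ-mono λ t → ℕ.⊔-monoʳ-≤ (lo t) (p⊆q⇒∣p∣≤∣q∣ (∩-monoˡ (V t) S⊆T))) ≤b

module PartitionFamily {n m : ℕ} {V : Fin m → Subset n} (isPartition : IsPartition V)
  {lo hi : Fin m → ℕ} {b : ℕ} (lo≤hi : ∀ t → lo t ℕ.≤ hi t) where

  I : Subset n → Set
  I = 𝓘 V lo hi b

  module _ (S : Subset n) {v : Fin n} {t : Fin m} (v∈Vt : v ∈ V t) where

    S∪v∩Vs : ∀ s → s ≢ t → ∣ (S ∪ ⁅ v ⁆) ∩ V s ∣ ℕ.≤ ∣ S ∩ V s ∣
    S∪v∩Vs s s≢t = p⊆q⇒∣p∣≤∣q∣ ⊆S
      where
      ⊆S : (S ∪ ⁅ v ⁆) ∩ V s ⊆ S ∩ V s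
      ⊆S x∈ with x∈p∩q⁻ (S ∪ ⁅ v ⁆) (V s) x∈
      ... | x∈S∪v , x∈Vs with x∈p∪q⁻ S ⁅ v ⁆ x∈S∪v
      ...   | inj₁ x∈S = x∈p∩q⁺ (x∈S , x∈Vs)
      ...   | inj₂ x∈v = contradiction
        (v , x∈p∩q⁺ (subst (_∈ V s) (x∈⁅y⁆⇒x≡y v x∈v) x∈Vs , v∈Vt)) (disjoint isPartition s t s≢t)

    S∪v∩Vt : ∣ (S ∪ ⁅ v ⁆) ∩ V t ∣ ℕ.≤ ℕ.suc ∣ S ∩ V t ∣
    S∪v∩Vt = ℕ.≤-trans (p⊆q⇒∣p∣≤∣q∣ ⊆S∪v) (∣p∪⁅v⁆∣≤1+∣p∣ (S ∩ V t) v)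
      where
      ⊆S∪v : (S ∪ ⁅ v ⁆) ∩ V t ⊆ (S ∩ V t) ∪ ⁅ v ⁆
      ⊆S∪v x∈ with x∈p∩q⁻ (S ∪ ⁅ v ⁆) (V t) x∈
      ... | x∈S∪v , x∈Vt with x∈p∪q⁻ S ⁅ v ⁆ x∈S∪v
      ...   | inj₁ x∈S = x∈p∪q⁺ (inj₁ (x∈p∩q⁺ (x∈S , x∈Vt)))
      ...   | inj₂ x∈v = x∈p∪q⁺ (inj₂ x∈v)

    extend-upper : I S → ∣ S ∩ V t ∣ ℕ.< hi t → ∀ s → ∣ (S ∪ ⁅ v ⁆) ∩ V s ∣ ℕ.≤ hi s
    extend-upper (≤hi , _) <hi s with s Fin.≟ t
    ... | yes ≡.refl = ℕ.≤-trans S∪v∩Vt <hi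
    ... | no  s≢t    = ℕ.≤-trans (S∪v∩Vs s s≢t) (≤hi s)

    -- A group below its lower quota is charged `lo t` in the budget both before and after the
    -- addition, so the budget does not move; `lo t ≤ hi t` takes care of the upper quota.
    extend-below-lo : I S → ∣ S ∩ V t ∣ ℕ.< lo t → I (S ∪ ⁅ v ⁆)
    extend-below-lo IS@(_ , ≤b) <lo = extend-upper IS (ℕ.<-≤-trans <lo (lo≤hi t))
                                    , ℕ.≤-trans (sumℕ-mono term) ≤b
      where
      term : ∀ s → lo s ℕ.⊔ ∣ (S ∪ ⁅ v ⁆) ∩ V s ∣ ℕ.≤ lo s ℕ.⊔ ∣ S ∩ V s ∣
      term s with s Fin.≟ t
      ... | yes ≡.refl = ℕ.≤-trans (ℕ.⊔-lub ℕ.≤-refl (ℕ.≤-trans S∪v∩Vt <lo)) (ℕ.m≤m⊔n (lo t) _)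
      ... | no  s≢t    = ℕ.⊔-monoʳ-≤ (lo s) (S∪v∩Vs s s≢t)

    -- With spare budget there is room for the one term that can grow, and it grows by at most one.
    extend-below-b : I S → ∣ S ∩ V t ∣ ℕ.< hi t → sumℕ (λ s → lo s ℕ.⊔ ∣ S ∩ V s ∣) ℕ.< b → I (S ∪ ⁅ v ⁆)
    extend-below-b IS <hi <b = extend-upper IS <hi , ℕ.≤-trans (sumℕ-bump t
      (λ s s≢t → ℕ.⊔-monoʳ-≤ (lo s) (S∪v∩Vs s s≢t))
      (ℕ.⊔-lub (ℕ.m≤n⇒m≤1+n (ℕ.m≤m⊔n (lo t) _)) (ℕ.≤-trans S∪v∩Vt (ℕ.s≤s (ℕ.m≤n⊔m (lo t) _))))) <b

  𝓘-∅ : sumℕ lo ℕ.≤ b → I ∅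
  𝓘-∅ ≤b = (λ t → ℕ.≤-trans (ℕ.≤-reflexive (∣∅∩V∣ t)) ℕ.z≤n)
         , ℕ.≤-trans (sumℕ-mono λ t → ℕ.⊔-lub ℕ.≤-refl (ℕ.≤-trans (ℕ.≤-reflexive (∣∅∩V∣ t)) ℕ.z≤n)) ≤b
    where
    ∣∅∩V∣ : ∀ t → ∣ ∅ ∩ V t ∣ ≡ 0
    ∣∅∩V∣ t = ≡.trans (cong ∣_∣ (∩-zeroˡ (V t))) (∣⊥∣≡0 n)

  maximal⇒lo≤ : ∀ {S} → (∀ t → lo t ℕ.≤ ∣ V t ∣) → I S → ¬ (∃[ v ] Addable I S v) →
    ∀ t → lo t ℕ.≤ ∣ S ∩ V t ∣
  maximal⇒lo≤ {S} lo≤∣V∣ IS maximal t with lo t ℕ.≤? ∣ S ∩ V t ∣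
  ... | yes lo≤ = lo≤
  ... | no  lo≰ with Fin.any? (λ v → v ∈? V t ×-dec ¬? (v ∈? S))
  ...   | yes (v , v∈Vt , v∉S) = contradiction (v , v∉S , extend-below-lo S v∈Vt IS (ℕ.≰⇒> lo≰)) maximal
  ...   | no  ¬v = contradiction (ℕ.≤-trans (lo≤∣V∣ t) (p⊆q⇒∣p∣≤∣q∣ Vt⊆)) lo≰
    where
    Vt⊆ : V t ⊆ S ∩ V t
    Vt⊆ {v} v∈Vt with v ∈? S
    ... | yes v∈S = x∈p∩q⁺ (v∈S , v∈Vt)
    ... | no  v∉S = contradiction (v , v∈Vt , v∉S) ¬v

  open Blocked I (𝓘? V lo hi b)

  module _ (R : OrderedRing) where

    open OrderedRing R
    open OrderedRingProperties R
    open import Algebra.Properties.Semiring.Sum semiring using (sum; sum-cong-≋; ∑-distrib-+)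
    open import Relation.Binary.Reasoning.PartialOrder poset

    -- blocked S is the closure of S in the matroid with independent sets I.
    module Rank (y : Fin n → Carrier)
      (0≤y : ∀ v → 0# ≤ y v) (y≤1 : ∀ v → y v ≤ 1#)
      (lo≤y : ∀ t → fromℕ (lo t) ≤ weight y (V t))
      (y≤hi : ∀ t → weight y (V t) ≤ fromℕ (hi t))
      (y≤b : weight y ⊤ ≤ fromℕ b) where

      -- If everything in the group outside `S` is addable, the blocked part of the group lies in
      -- `S`, and each of its elements weighs at most 1.
      blocked-part≤ : ∀ S t → (∀ {v} → v ∈ V t → v ∉ S → Addable I S v) →
        weight y (blocked S ∩ V t) ≤ fromℕ ∣ S ∩ V t ∣
      blocked-part≤ S t free = ≤-trans (weight-mono 0≤y ⊆S) (weight≤∣∣ (S ∩ V t) y≤1)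
        where
        ⊆S : blocked S ∩ V t ⊆ S ∩ V t
        ⊆S {v} v∈ with x∈p∩q⁻ (blocked S) (V t) v∈ | v ∈? S
        ... | v∈C , v∈Vt | yes v∈S = x∈p∩q⁺ (v∈S , v∈Vt)
        ... | v∈C , v∈Vt | no  v∉S = contradiction (free v∈Vt v∉S) (∈-blocked⁻ v∈C)

      blocked-part≤V : ∀ S t → weight y (blocked S ∩ V t) ≤ weight y (V t)
      blocked-part≤V S t = weight-mono 0≤y (p∩q⊆q (blocked S) (V t))

      fromℕ-∣∣-partition : ∀ S → sum (λ t → fromℕ ∣ S ∩ V t ∣) ≈ fromℕ ∣ S ∣
      fromℕ-∣∣-partition S = trans (sym (fromℕ-sum λ t → ∣ S ∩ V t ∣))
        (reflexive (cong fromℕ (∣∣-partition isPartition S)))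

      weight-V : sum (λ t → weight y (V t)) ≤ fromℕ b
      weight-V = begin
        sum (λ t → weight y (V t))      ≈⟨ sum-cong-≋ (λ t →
          reflexive (cong (weight y) (≡.sym (∩-identityˡ (V t))))) ⟩
        sum (λ t → weight y (⊤ ∩ V t))  ≈⟨ weight-partition isPartition y ⊤ ⟩
        weight y ⊤                      ≤⟨ y≤b ⟩
        fromℕ b                         ∎

      -- An element can be blocked by its upper quota or by the budget. With spare budget only the
      -- quotas block, and the inequality holds group by group. With an exhausted budget it holds
      -- only after summation.
      rank : ∀ S → I S → weight y (blocked S) ≤ fromℕ ∣ S ∣
      rank S IS@(≤hi , ≤b) with ℕ.m≤n⇒m<n∨m≡n ≤b
      ... | inj₁ <b = begin
        weight y (blocked S)                     ≈⟨ weight-partition isPartition y (blocked S) ⟨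
        sum (λ t → weight y (blocked S ∩ V t))   ≤⟨ sum-mono part ⟩
        sum (λ t → fromℕ ∣ S ∩ V t ∣)            ≈⟨ fromℕ-∣∣-partition S ⟩
        fromℕ ∣ S ∣                              ∎
        where
        part : ∀ t → weight y (blocked S ∩ V t) ≤ fromℕ ∣ S ∩ V t ∣
        part t with ℕ.m≤n⇒m<n∨m≡n (≤hi t)
        ... | inj₁ <hi = blocked-part≤ S t λ v∈Vt v∉S → v∉S , extend-below-b S v∈Vt IS <hi <b
        -- A full group may be blocked entirely, but its whole weight is at most its quota, which is
        -- its share of `S`.
        ... | inj₂ ≡hi = ≤-trans (blocked-part≤V S t)
          (≤-trans (y≤hi t) (≤-reflexive (reflexive (cong fromℕ (≡.sym ≡hi)))))
      -- Add `b` to both sides: on the left it is the sum of the budget terms `k t`, on the right it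
      -- bounds the total weight of all groups.
      ... | inj₂ ≡b = +-cancelʳ-≤ (fromℕ b) (begin
        weight y (blocked S) + fromℕ b
          ≈⟨ +-cong (weight-partition isPartition y (blocked S))
               (trans (sym (fromℕ-sum k)) (reflexive (cong fromℕ ≡b))) ⟨
        sum (λ t → weight y (blocked S ∩ V t)) + sum (fromℕ ∘ k)
          ≈⟨ ∑-distrib-+ (λ t → weight y (blocked S ∩ V t)) (fromℕ ∘ k) ⟨
        sum (λ t → weight y (blocked S ∩ V t) + fromℕ (k t))
          ≤⟨ sum-mono part ⟩
        sum (λ t → weight y (V t) + fromℕ ∣ S ∩ V t ∣)
          ≈⟨ ∑-distrib-+ (λ t → weight y (V t)) (λ t → fromℕ ∣ S ∩ V t ∣) ⟩
        sum (λ t → weight y (V t)) + sum (λ t → fromℕ ∣ S ∩ V t ∣)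
          ≤⟨ +-mono-≤ weight-V (≤-reflexive (fromℕ-∣∣-partition S)) ⟩
        fromℕ b + fromℕ ∣ S ∣
          ≈⟨ +-comm (fromℕ b) (fromℕ ∣ S ∣) ⟩
        fromℕ ∣ S ∣ + fromℕ b ∎)
        where
        k : Fin m → ℕ
        k t = lo t ℕ.⊔ ∣ S ∩ V t ∣
        part : ∀ t → weight y (blocked S ∩ V t) + fromℕ (k t) ≤ weight y (V t) + fromℕ ∣ S ∩ V t ∣
        part t with lo t ℕ.≤? ∣ S ∩ V t ∣
        -- At or above the lower quota the budget term is the size of the part of `S` in the group.
        ... | yes lo≤ = +-mono-≤ (blocked-part≤V S t)
          (≤-reflexive (reflexive (cong fromℕ (ℕ.m≤n⇒m⊔n≡n lo≤))))
        -- Below the lower quota the two summands trade places: the blocked weight is bounded by the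
        -- part of `S`, and the budget term `lo t` by the weight of the group.
        ... | no  lo≰ = ≤-trans
          (+-mono-≤ (blocked-part≤ S t λ v∈Vt v∉S → v∉S , extend-below-lo S v∈Vt IS (ℕ.≰⇒> lo≰))
            (≤-trans (≤-reflexive (reflexive (cong fromℕ (ℕ.m≥n⇒m⊔n≡m (ℕ.<⇒≤ (ℕ.≰⇒> lo≰)))))) (lo≤y t)))
          (≤-reflexive (+-comm (fromℕ ∣ S ∩ V t ∣) (weight y (V t))))

-- Submodular functions and the greedy algorithm

module _ (R : OrderedRing) where

  open OrderedRing R
  open OrderedRingProperties R
  open import Algebra.Properties.Semiring.Sum semiring
    using (sum; sum-cong-≋; ∑-distrib-+; *-distribˡ-sum; *-distribʳ-sum)
  open import Algebra.Solver.Ring.NaturalCoefficients.Default commutativeSemiring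
    using (solve; _:=_; _:+_; _:*_; con)
  open import Relation.Binary.Reasoning.PartialOrder poset

  module Marginals {n : ℕ} (f : Subset n → Carrier)
    (f-mono : ∀ S T → S ⊆ T → f S ≤ f T)
    (f-submodular : ∀ S T v → S ⊆ T → v ∉ T → f (T ∪ ⁅ v ⁆) - f T ≤ f (S ∪ ⁅ v ⁆) - f S) where

    gain : Subset n → Fin n → Carrier
    gain S v = f (S ∪ ⁅ v ⁆) - f S

    gain-nonneg : ∀ S v → 0# ≤ gain S v
    gain-nonneg S v = x≤y⇒0≤y-x (f-mono S (S ∪ ⁅ v ⁆) (p⊆p∪q ⁅ v ⁆))

    -- Submodularity speaks of `v ∉ T` only; for `v ∈ T` the gain over `T` is at most zero and
    -- monotonicity suffices.
    gain-antitone : ∀ {S T} v → S ⊆ T → gain T v ≤ gain S v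
    gain-antitone {S} {T} v S⊆T with v ∈? T
    ... | no  v∉T = f-submodular S T v S⊆T v∉T
    ... | yes v∈T = begin
      f (T ∪ ⁅ v ⁆) - f T  ≤⟨ +-mono-≤ (f-mono (T ∪ ⁅ v ⁆) T T∪v⊆T) ≤-refl ⟩
      f T - f T            ≈⟨ -‿inverseʳ (f T) ⟩
      0#                   ≤⟨ gain-nonneg S v ⟩
      gain S v             ∎
      where
      T∪v⊆T : T ∪ ⁅ v ⁆ ⊆ T
      T∪v⊆T x∈ with x∈p∪q⁻ T ⁅ v ⁆ x∈
      ... | inj₁ x∈T = x∈T
      ... | inj₂ x∈v = subst (_∈ T) (≡.sym (x∈⁅y⁆⇒x≡y v x∈v)) v∈T

    f+gain : ∀ S v → f S + gain S v ≈ f (S ∪ ⁅ v ⁆)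
    f+gain S v = x+[y-x]≈y (f S) (f (S ∪ ⁅ v ⁆))

    -- B ⊇ A is generalised from A so that the elements can be added one at a time.
    add-family : ∀ {k} A B (w : Fin k → Fin n) (S : Subset k) → A ⊆ B →
      Σ[ T ∈ Subset n ] (B ⊆ T × (∀ {i} → i ∈ S → w i ∈ T) × f T ≤ f B + sum (λ i → χ S i * gain A (w i)))
    add-family A B w Vec.[] A⊆B = B , id , (λ ()) , ≤-reflexive (sym (+-identityʳ (f B)))
    add-family A B w (outside Vec.∷ S) A⊆B with add-family A B (w ∘ suc) S A⊆B
    ... | T , B⊆T , S⊆T , fT≤ = T , B⊆T , (λ { (Vec.there i∈S) → S⊆T i∈S }) , (begin
      f T             ≤⟨ fT≤ ⟩
      f B + s         ≈⟨ +-congˡ (trans (+-congʳ (zeroˡ (gain A (w zero)))) (+-identityˡ s)) ⟨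
      f B + (0# * gain A (w zero) + s) ∎)
      where
      s = sum λ i → χ S i * gain A (w (suc i))
    add-family A B w (inside Vec.∷ S) A⊆B
      with add-family A (B ∪ ⁅ w zero ⁆) (w ∘ suc) S (⊆-trans A⊆B (p⊆p∪q ⁅ w zero ⁆))
    ... | T , B∪v⊆T , S⊆T , fT≤ = T , B∪v⊆T ∘ p⊆p∪q ⁅ w zero ⁆ , S⊆T′ , (begin
      f T                       ≤⟨ fT≤ ⟩
      f (B ∪ ⁅ v ⁆) + s         ≈⟨ +-congʳ (f+gain B v) ⟨
      f B + gain B v + s        ≤⟨ +-mono-≤ (+-mono-≤ ≤-refl (gain-antitone v A⊆B)) ≤-refl ⟩
      f B + gain A v + s        ≈⟨ solve 3 (λ b g s → b :+ g :+ s := b :+ (con 1 :* g :+ s))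
        refl (f B) (gain A v) s ⟩
      f B + (1# * gain A v + s) ∎)
      where
      v = w zero
      s = sum λ i → χ S i * gain A (w (suc i))
      S⊆T′ : ∀ {i} → i ∈ inside Vec.∷ S → w i ∈ T
      S⊆T′ Vec.here        = B∪v⊆T (q⊆p∪q B ⁅ v ⁆ (x∈⁅x⁆ v))
      S⊆T′ (Vec.there i∈S) = S⊆T i∈S

    -- Monotonicity leads from `S` to a set `T` containing `S` that is built from `A` by adding the
    -- elements of `S` one by one.
    f≤f+gains : ∀ A S → f S ≤ f A + weight (gain A) S
    f≤f+gains A S with add-family A A id S id
    ... | T , _ , S⊆T , fT≤ = ≤-trans (f-mono S T S⊆T) fT≤

    module _ (I : Subset n → Set) (I? : ∀ S → Dec (I S)) where

      open Blocked I I?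

      module GreedyChain (0≤f : ∀ S → 0# ≤ f S) (I-downward : ∀ {S T} → S ⊆ T → I T → I S)
        (y : Fin n → Carrier) (0≤y : ∀ v → 0# ≤ y v)
        (rank : ∀ S → I S → weight y (blocked S) ≤ fromℕ ∣ S ∣) (A : Subset n) where

        -- Along the run `g` is the gain of the greedy step that produced `S`; at the start it is a
        -- crude upper bound.
        price : Subset n → Carrier → Fin n → Carrier
        price S g v = if lookup (blocked S) v then g else gain A v

        price-∈ : ∀ {S g v} → v ∈ blocked S → price S g v ≈ g
        price-∈ {g = g} {v} v∈ = reflexive (cong (if_then g else gain A v) ([]=⇒lookup v∈))

        price-∉ : ∀ {S g v} → v ∉ blocked S → price S g v ≈ gain A v
        price-∉ {g = g} {v} v∉ = reflexive (cong (if_then g else gain A v) (∉⇒lookup v∉))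

        cost : Subset n → Carrier → Carrier
        cost S g = sum λ v → price S g v * y v

        -- The invariant, proved backwards along the run of the algorithm from S to
        -- A: an element blocked at S is charged g, any other its gain over A.
        Bound : Subset n → Set
        Bound S = ∀ g → 0# ≤ g → (∀ v → Addable I S v → gain S v ≤ g) →
          cost S g + f S ≤ f A + fromℕ ∣ S ∣ * g

        -- At the end every element is blocked and pays `g`, so the cost is `g` times the weight of
        -- `blocked A`, which the rank inequality bounds.
        bound-maximal : I A → ¬ (∃[ v ] Addable I A v) → Bound A
        bound-maximal IA maximal g 0≤g _ = begin
          cost A g + f A                                ≈⟨ +-congʳ (sum-cong-≋ λ v → trans
            (*-congʳ (price-∈ (all v))) (trans (*-comm g (y v)) (*-congʳ (y≈χ*y v)))) ⟩
          sum (λ v → χ (blocked A) v * y v * g) + f A   ≈⟨ +-congʳ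
            (*-distribʳ-sum g (λ v → χ (blocked A) v * y v)) ⟨
          weight y (blocked A) * g + f A                ≤⟨ +-mono-≤ (*-monoˡ-≤ 0≤g (rank A IA)) ≤-refl ⟩
          fromℕ ∣ A ∣ * g + f A                         ≈⟨ +-comm (fromℕ ∣ A ∣ * g) (f A) ⟩
          f A + fromℕ ∣ A ∣ * g                         ∎
          where
          all : ∀ v → v ∈ blocked A
          all v = ∈-blocked⁺ λ a → maximal (v , a)
          y≈χ*y : ∀ v → y v ≈ χ (blocked A) v * y v
          y≈χ*y v = trans (sym (*-identityˡ (y v))) (*-congʳ (sym (χ-∈ (all v))))

        module _ {S a} (IS : I S) (S⊆A : S ⊆ A)
          (greedy : ∀ w → Addable I S w → gain S w ≤ gain S a) where

          private
            S′ = S ∪ ⁅ a ⁆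
            S⊆S′ : S ⊆ S′
            S⊆S′ = p⊆p∪q ⁅ a ⁆
            c = gain S a

          addable-antitone : ∀ {v} → Addable I S′ v → Addable I S v
          addable-antitone {v} (v∉S′ , IS′v) = v∉S′ ∘ S⊆S′ , I-downward (∪-monoˡ ⁅ v ⁆ S⊆S′) IS′v

          -- What is blocked at `S` stays blocked and its price changes from `g` to `c`. What
          -- becomes blocked now was a candidate at `S`, so its gain over `A` is at most its gain
          -- over `S`, hence at most `c`. All other prices are unchanged.
          price-step : ∀ g v → price S g v ≤ price S′ c v + (g - c) * χ (blocked S) v
          price-step g v with v ∈? blocked S | v ∈? blocked S′
          ... | yes v∈ | no v∉′ = contradiction (∈-blocked⁺ (∈-blocked⁻ v∈ ∘ addable-antitone)) v∉′
          ... | yes v∈ | yes v∈′ = ≤-reflexive (begin-equality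
            price S g v                                  ≈⟨ price-∈ v∈ ⟩
            g                                            ≈⟨ x+[y-x]≈y c g ⟨
            c + (g - c)                                  ≈⟨ +-cong (price-∈ v∈′)
              (trans (*-congˡ (χ-∈ v∈)) (*-identityʳ (g - c))) ⟨
            price S′ c v + (g - c) * χ (blocked S) v     ∎)
          ... | no v∉ | v∈?′ = begin
            price S g v                                  ≈⟨ price-∉ v∉ ⟩
            gain A v                                     ≤⟨ gain≤price v∈?′ ⟩
            price S′ c v                                 ≈⟨ +-identityʳ (price S′ c v) ⟨
            price S′ c v + 0#                            ≈⟨ +-congˡ
              (trans (*-congˡ (χ-∉ v∉)) (zeroʳ (g - c))) ⟨
            price S′ c v + (g - c) * χ (blocked S) v     ∎
            where
            gain≤price : Dec (v ∈ blocked S′) → gain A v ≤ price S′ c v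
            gain≤price (no  v∉′) = ≤-reflexive (sym (price-∉ v∉′))
            gain≤price (yes v∈′) = begin
              gain A v      ≤⟨ gain-antitone v S⊆A ⟩
              gain S v      ≤⟨ greedy v (∉-blocked v∉) ⟩
              c             ≈⟨ price-∈ v∈′ ⟨
              price S′ c v  ∎

          -- Summing the price changes leaves `g - c` times the weight of `blocked S`. The rank
          -- inequality may be multiplied by this factor because the gains decrease.
          cost-step : ∀ {g} → c ≤ g → cost S g ≤ cost S′ c + (g - c) * fromℕ ∣ S ∣
          cost-step {g} c≤g = begin
            cost S g
              ≤⟨ sum-mono (λ v → *-monoˡ-≤ (0≤y v) (price-step g v)) ⟩
            sum (λ v → (price S′ c v + d * χ (blocked S) v) * y v)
              ≈⟨ sum-cong-≋ (λ v → solve 4 (λ p d x y → (p :+ d :* x) :* y := p :* y :+ d :* (x :* y))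
                   refl (price S′ c v) d (χ (blocked S) v) (y v)) ⟩
            sum (λ v → price S′ c v * y v + d * (χ (blocked S) v * y v))
              ≈⟨ ∑-distrib-+ (λ v → price S′ c v * y v) (λ v → d * (χ (blocked S) v * y v)) ⟩
            cost S′ c + sum (λ v → d * (χ (blocked S) v * y v))
              ≈⟨ +-congˡ (*-distribˡ-sum d (λ v → χ (blocked S) v * y v)) ⟨
            cost S′ c + d * weight y (blocked S)
              ≤⟨ +-mono-≤ ≤-refl (*-monoʳ-≤ (x≤y⇒0≤y-x c≤g) (rank S IS)) ⟩
            cost S′ c + d * fromℕ ∣ S ∣ ∎
            where
            d = g - c

          -- Adding `c` to both sides turns `f S` into `f S′`. On the right, `c` for each of the at
          -- most |S| + 1 elements of `S′` plus `g - c` for each element of `S` makes `g` for each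
          -- element of `S`, plus the `c` that cancels.
          bound-step : Addable I S a → Bound S′ → Bound S
          bound-step addable bound′ g 0≤g gain≤g = +-cancelʳ-≤ c (begin
            cost S g + f S + c
              ≤⟨ +-mono-≤ (+-mono-≤ (cost-step (gain≤g a addable)) ≤-refl) ≤-refl ⟩
            cost S′ c + d * N + f S + c
              ≈⟨ solve 4 (λ x y z w → x :+ y :+ z :+ w := x :+ (z :+ w) :+ y) refl
                 (cost S′ c) (d * N) (f S) c ⟩
            cost S′ c + (f S + c) + d * N
              ≈⟨ +-congʳ (+-congˡ (f+gain S a)) ⟩
            cost S′ c + f S′ + d * N
              -- `c` is a valid price at `S′`: a candidate there was already a candidate at `S`,
              -- with a gain at least as large, which the greedy choice bounds by `c`.
              ≤⟨ +-mono-≤ (bound′ c 0≤c λ w w-addable →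
                   ≤-trans (gain-antitone w S⊆S′) (greedy w (addable-antitone w-addable))) ≤-refl ⟩
            f A + fromℕ ∣ S′ ∣ * c + d * N
              ≤⟨ +-mono-≤ (+-mono-≤ ≤-refl (*-monoˡ-≤ 0≤c
                   (≤-trans (fromℕ-mono (∣p∪⁅v⁆∣≤1+∣p∣ S a)) (≤-reflexive (fromℕ-suc ∣ S ∣))))) ≤-refl ⟩
            f A + (1# + N) * c + d * N
              ≈⟨ solve 4 (λ a N c d → a :+ (con 1 :+ N) :* c :+ d :* N := a :+ N :* (c :+ d) :+ c) refl
                 (f A) N c d ⟩
            f A + N * (c + d) + c
              ≈⟨ +-congʳ (+-congˡ (*-congˡ (x+[y-x]≈y c g))) ⟩
            f A + N * g + c ∎)
            where
            N = fromℕ ∣ S ∣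
            d = g - c
            0≤c = gain-nonneg S a

        -- The initial price `f ⊤` exceeds every gain and costs nothing, since it is multiplied by
        -- the size of the empty set.
        bound-∅ : Bound ∅ → sum (λ v → gain A v * y v) ≤ f A
        bound-∅ bound = begin
          sum (λ v → gain A v * y v)     ≤⟨ sum-mono (λ v → *-monoˡ-≤ (0≤y v) (gain≤price v)) ⟩
          cost ∅ (f ⊤)                   ≤⟨ ≤-trans (x≤y+x (0≤f ∅))
          (≤-reflexive (+-comm (f ∅) (cost ∅ (f ⊤)))) ⟩
          cost ∅ (f ⊤) + f ∅             ≤⟨ bound (f ⊤) (0≤f ⊤) (λ v _ → gain≤f⊤ ∅ v) ⟩
          f A + fromℕ ∣ ∅ {n} ∣ * f ⊤    ≈⟨ +-congˡ (trans
          (*-congʳ (trans (reflexive (cong fromℕ (∣⊥∣≡0 n))) fromℕ-zero)) (zeroˡ (f ⊤))) ⟩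
          f A + 0#                       ≈⟨ +-identityʳ (f A) ⟩
          f A                            ∎
          where
          gain≤f⊤ : ∀ S v → gain S v ≤ f ⊤
          gain≤f⊤ S v = begin
            gain S v               ≤⟨ x≤y+x (0≤f S) ⟩
            f S + gain S v         ≈⟨ f+gain S v ⟩
            f (S ∪ ⁅ v ⁆)          ≤⟨ f-mono (S ∪ ⁅ v ⁆) ⊤ ⊆⊤ ⟩
            f ⊤                    ∎
          gain≤price : ∀ v → gain A v ≤ price ∅ (f ⊤) v
          gain≤price v with lookup (blocked ∅) v
          ... | true  = gain≤f⊤ A v
          ... | false = ≤-refl

-- Convex combinations of subsets

module Fractional (R : OrderedRing) where

  open OrderedRing R
  open OrderedRingProperties R
  open import Algebra.Properties.Semiring.Sum semiring
    using (sum; sum-cong-≋; ∑-distrib-+; *-distribˡ-sum; sum-replicate-zero)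
  open import Algebra.Solver.Ring.NaturalCoefficients.Default commutativeSemiring
    using (solve; _:=_; _:+_; _:*_)
  open import Relation.Binary.Reasoning.PartialOrder poset

  -- Over the reals this unfolds to `∑`, so the constraints of P.0 apply as they stand.
  listSum : {A : Set} → List A → (A → Carrier) → Carrier
  listSum as g = foldr (λ a s → g a + s) 0# as

  listSum-mono : ∀ {A : Set} {g h : A → Carrier} as →
    (∀ {a} → a List.∈ as → g a ≤ h a) → listSum as g ≤ listSum as h
  listSum-mono []       g≤h = ≤-refl
  listSum-mono (a ∷ as) g≤h = +-mono-≤ (g≤h (here ≡.refl)) (listSum-mono as (g≤h ∘ there))

  listSum-cong : ∀ {A : Set} {g h : A → Carrier} as → (∀ a → g a ≈ h a) → listSum as g ≈ listSum as h
  listSum-cong []       g≈h = refl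
  listSum-cong (a ∷ as) g≈h = +-cong (g≈h a) (listSum-cong as g≈h)

  listSum-nonneg : ∀ {A : Set} {g : A → Carrier} as →
    (∀ {a} → a List.∈ as → 0# ≤ g a) → 0# ≤ listSum as g
  listSum-nonneg []       0≤g = ≤-refl
  listSum-nonneg (a ∷ as) 0≤g = ≤-trans (0≤g (here ≡.refl))
    (≤-trans (x≤y+x (listSum-nonneg as (0≤g ∘ there)))
      (≤-reflexive (+-comm _ _)))

  listSum-affine : ∀ {A : Set} (x g : A → Carrier) c as →
    listSum as (λ a → x a * (c + g a)) ≈ listSum as x * c + listSum as (λ a → x a * g a)
  listSum-affine x g c []       = sym (trans (+-identityʳ (0# * c)) (zeroˡ c))
  listSum-affine x g c (a ∷ as) = trans (+-congˡ (listSum-affine x g c as))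
    (solve 5 (λ x s c g t → x :* (c :+ g) :+ (s :* c :+ t) := (x :+ s) :* c :+ (x :* g :+ t)) refl
      (x a) (listSum as x) c (g a) (listSum as λ a → x a * g a))

  listSum-*ʳ : ∀ {A : Set} (x : A → Carrier) c as → listSum as (λ a → x a * c) ≈ listSum as x * c
  listSum-*ʳ x c []       = sym (zeroˡ c)
  listSum-*ʳ x c (a ∷ as) = trans (+-congˡ (listSum-*ʳ x c as)) (sym (distribʳ c (x a) (listSum as x)))

  -- The probability that `v` belongs to a random set drawn with probabilities `x`.
  marginal : ∀ {n} → List (Subset n) → (Subset n → Carrier) → Fin n → Carrier
  marginal Ss x v = listSum Ss λ S → x S * χ S v

  -- Exchange of the sum over sets with the sum over elements.
  listSum-weight : ∀ {n} (x : Subset n → Carrier) h Ss →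
    listSum Ss (λ S → x S * weight h S) ≈ sum (λ v → h v * marginal Ss x v)
  listSum-weight {n} x h []       = sym (trans (sum-cong-≋ λ v → zeroʳ (h v)) (sum-replicate-zero n))
  listSum-weight x h (S ∷ Ss) = begin-equality
    x S * weight h S + listSum Ss (λ S → x S * weight h S)
      ≈⟨ +-cong (*-distribˡ-sum (x S) (λ v → χ S v * h v)) (listSum-weight x h Ss) ⟩
    sum (λ v → x S * (χ S v * h v)) + sum (λ v → h v * marginal Ss x v)
      ≈⟨ ∑-distrib-+ (λ v → x S * (χ S v * h v)) (λ v → h v * marginal Ss x v) ⟨
    sum (λ v → x S * (χ S v * h v) + h v * marginal Ss x v)
      ≈⟨ sum-cong-≋ (λ v → solve 4 (λ x k h y → x :* (k :* h) :+ h :* y := h :* (x :* k :+ y)) refl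
           (x S) (χ S v) (h v) (marginal Ss x v)) ⟩
    sum (λ v → h v * marginal (S ∷ Ss) x v) ∎

  weight-χ : ∀ {n} (S T : Subset n) → weight (χ T) S ≈ fromℕ ∣ S ∩ T ∣
  weight-χ S T = trans (sum-cong-≋ χ-∩) (sym (fromℕ-∣∣ (S ∩ T)))
    where
    χ-∩ : ∀ v → χ S v * χ T v ≈ χ (S ∩ T) v
    χ-∩ v with v ∈? S | v ∈? T
    ... | yes v∈S | yes v∈T = trans (*-cong (χ-∈ v∈S) (χ-∈ v∈T))
      (trans (*-identityˡ 1#) (sym (χ-∈ (x∈p∩q⁺ (v∈S , v∈T)))))
    ... | no  v∉S | _       = trans (*-congʳ (χ-∉ v∉S))
      (trans (zeroˡ (χ T v)) (sym (χ-∉ (v∉S ∘ p∩q⊆p S T))))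
    ... | yes _   | no v∉T  = trans (*-congˡ (χ-∉ v∉T))
      (trans (zeroʳ (χ S v)) (sym (χ-∉ (v∉T ∘ p∩q⊆q S T))))

  -- Rewrites the constraint sums of P.0 as weights under the marginals, the form that the rank
  -- inequality takes as input.
  weight-marginal : ∀ {n} (x : Subset n → Carrier) Ss T →
    listSum Ss (λ S → x S * fromℕ ∣ S ∩ T ∣) ≈ weight (marginal Ss x) T
  weight-marginal x Ss T = trans
    (listSum-cong Ss λ S → *-congˡ (sym (weight-χ S T))) (listSum-weight x (χ T) Ss)

  module SubDistribution {n : ℕ} (Ss : List (Subset n)) (x : Subset n → Carrier)
    (0≤x : ∀ {S} → S List.∈ Ss → 0# ≤ x S) (total : listSum Ss x ≤ 1#) where

    0≤marginal : ∀ v → 0# ≤ marginal Ss x v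
    0≤marginal v = listSum-nonneg Ss λ {S} S∈ → *-nonneg (0≤x S∈) (χ-nonneg S v)

    marginal≤1 : ∀ v → marginal Ss x v ≤ 1#
    marginal≤1 v = ≤-trans (listSum-mono Ss λ {S} S∈ →
      ≤-trans (*-monoʳ-≤ (0≤x S∈) (χ≤1 S v)) (≤-reflexive (*-identityʳ (x S)))) total

    -- The total mass may fall short of 1, hence the condition `0# ≤ c`.
    listSum-≤-const : ∀ (g : Subset n → Carrier) {c} → 0# ≤ c → (∀ {S} → S List.∈ Ss → g S ≤ c) →
      listSum Ss (λ S → x S * g S) ≤ c
    listSum-≤-const g {c} 0≤c g≤c = begin
      listSum Ss (λ S → x S * g S)  ≤⟨ listSum-mono Ss (λ S∈ → *-monoʳ-≤ (0≤x S∈) (g≤c S∈)) ⟩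
      listSum Ss (λ S → x S * c)    ≈⟨ listSum-*ʳ x c Ss ⟩
      listSum Ss x * c              ≤⟨ *-monoˡ-≤ 0≤c total ⟩
      1# * c                        ≈⟨ *-identityˡ c ⟩
      c                             ∎

    -- The total marginal weight is the expected size of the random set.
    weight-⊤≤ : ∀ {b} → (∀ {S} → S List.∈ Ss → ∣ S ∣ ℕ.≤ b) → weight (marginal Ss x) ⊤ ≤ fromℕ b
    weight-⊤≤ {b} ∣S∣≤b = begin
      weight (marginal Ss x) ⊤                    ≈⟨ weight-marginal x Ss ⊤ ⟨
      listSum Ss (λ S → x S * fromℕ ∣ S ∩ ⊤ ∣)    ≤⟨ listSum-≤-const (λ S → fromℕ ∣ S ∩ ⊤ ∣)
        (fromℕ-nonneg b) (λ {S} S∈ → fromℕ-mono (ℕ.≤-trans (∣p∩q∣≤∣p∣ S ⊤) (∣S∣≤b S∈))) ⟩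
      fromℕ b                                     ∎

    -- Averages a bound that holds set by set; meant for `f`, with constant `f A` and element
    -- weights `gain A`.
    listSum-≤-affine : ∀ (g : Subset n → Carrier) h {c} → 0# ≤ c → (∀ S → g S ≤ c + weight h S) →
      listSum Ss (λ S → x S * g S) ≤ c + sum (λ v → h v * marginal Ss x v)
    listSum-≤-affine g h {c} 0≤c g≤ = begin
      listSum Ss (λ S → x S * g S)                              ≤⟨ listSum-mono Ss (λ {S} S∈ →
        *-monoʳ-≤ (0≤x S∈) (g≤ S)) ⟩
      listSum Ss (λ S → x S * (c + weight h S))                 ≈⟨ listSum-affine x (weight h) c Ss ⟩
      listSum Ss x * c + listSum Ss (λ S → x S * weight h S)    ≤⟨ +-mono-≤
        (≤-trans (*-monoˡ-≤ 0≤c total) (≤-reflexive (*-identityˡ c)))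
        (≤-reflexive (listSum-weight x h Ss)) ⟩
      c + sum (λ v → h v * marginal Ss x v)                     ∎

-- The reals form an ordered commutative ring

open import Defs

module RealNumbers where

  open import Data.Rational.Solver using (module +-*-Solver)
  open +-*-Solver using (solve; _:=_; _:+_; _:*_; _:-_; :-_; con)
  open CauchyLemmas using (inv; pos*; bounded)

  pointwise-≤ : ∀ {x y} → (∀ n → seq x n ℚ.≤ seq y n) → x ≤ y
  pointwise-≤ {x} {y} x≤y = *≤* λ ε ε>0 → 0 , λ n _ → ℚ.≤-trans (x≤y n)
    (ℚ.≤-trans (ℚ.≤-reflexive (≡.sym (ℚ.+-identityʳ (seq y n)))) (ℚ.+-monoʳ-≤ (seq y n) (ℚ.<⇒≤ ε>0)))

  pointwise-≃ : ∀ {x y} → (∀ n → seq x n ≡ seq y n) → x ≃ y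
  pointwise-≃ x≡y = pointwise-≤ (λ n → ℚ.≤-reflexive (x≡y n))
                  , pointwise-≤ (λ n → ℚ.≤-reflexive (≡.sym (x≡y n)))

  half-pos : ∀ {ε} → 0ℚ ℚ.< ε → 0ℚ ℚ.< ½ ℚ.* ε
  half-pos = pos* (ℚ.positive⁻¹ ½)

  halves : ∀ ε → ½ ℚ.* ε ℚ.+ ½ ℚ.* ε ≡ ε
  halves = solve 1 (λ ε → con ½ :* ε :+ con ½ :* ε := ε) ≡.refl

  ≤-refl : ∀ {x} → x ≤ x
  ≤-refl = pointwise-≤ λ n → ℚ.≤-refl

  ≤-trans : ∀ {x y z} → x ≤ y → y ≤ z → x ≤ z
  ≤-trans {x} {y} {z} (*≤* x≤y) (*≤* y≤z) = *≤* λ ε ε>0 →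
    let (M , h) = x≤y (½ ℚ.* ε) (half-pos ε>0) ; (N , k) = y≤z (½ ℚ.* ε) (half-pos ε>0) in
    M ℕ.⊔ N , λ n ≤n → let open ℚ.≤-Reasoning in begin
      seq x n                             ≤⟨ h n (ℕ.m⊔n≤o⇒m≤o M N ≤n) ⟩
      seq y n ℚ.+ ½ ℚ.* ε                 ≤⟨ ℚ.+-monoˡ-≤ (½ ℚ.* ε) (k n (ℕ.m⊔n≤o⇒n≤o M N ≤n)) ⟩
      seq z n ℚ.+ ½ ℚ.* ε ℚ.+ ½ ℚ.* ε     ≡⟨ ℚ.+-assoc (seq z n) (½ ℚ.* ε) (½ ℚ.* ε) ⟩
      seq z n ℚ.+ (½ ℚ.* ε ℚ.+ ½ ℚ.* ε)   ≡⟨ cong (seq z n ℚ.+_) (halves ε) ⟩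
      seq z n ℚ.+ ε                       ∎

  +-mono-≤ : ∀ {x y u v} → x ≤ y → u ≤ v → x + u ≤ y + v
  +-mono-≤ {x} {y} {u} {v} (*≤* x≤y) (*≤* u≤v) = *≤* λ ε ε>0 →
    let (M , h) = x≤y (½ ℚ.* ε) (half-pos ε>0) ; (N , k) = u≤v (½ ℚ.* ε) (half-pos ε>0) in
    M ℕ.⊔ N , λ n ≤n → let open ℚ.≤-Reasoning in begin
      seq x n ℚ.+ seq u n                                      ≤⟨ ℚ.+-mono-≤
        (h n (ℕ.m⊔n≤o⇒m≤o M N ≤n)) (k n (ℕ.m⊔n≤o⇒n≤o M N ≤n)) ⟩
      (seq y n ℚ.+ ½ ℚ.* ε) ℚ.+ (seq v n ℚ.+ ½ ℚ.* ε)          ≡⟨ solve 3 (λ y v ε →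
        (y :+ con ½ :* ε) :+ (v :+ con ½ :* ε) := (y :+ v) :+ ε) ≡.refl (seq y n) (seq v n) ε ⟩
      (seq y n ℚ.+ seq v n) ℚ.+ ε                              ∎

  p≤∣p∣ : ∀ p → p ℚ.≤ ℚ.∣ p ∣
  p≤∣p∣ p with ℚ.≤-total 0ℚ p
  ... | inj₁ 0≤p = ℚ.≤-reflexive (≡.sym (ℚ.0≤p⇒∣p∣≡p 0≤p))
  ... | inj₂ p≤0 = ℚ.≤-trans p≤0 (ℚ.0≤∣p∣ p)

  upper-bound : ∀ x → Σ[ B ∈ ℚ ] (0ℚ ℚ.< B × ∃[ N ] (∀ n → N ℕ.≤ n → seq x n ℚ.≤ B))
  upper-bound x with bounded (seq x) (cauchy x)
  ... | B , B>0 , N , h = B , B>0 , N , λ n N≤n → ℚ.≤-trans (p≤∣p∣ (seq x n)) (h n N≤n)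

  0≤* : ∀ {p q} → 0ℚ ℚ.≤ p → 0ℚ ℚ.≤ q → 0ℚ ℚ.≤ p ℚ.* q
  0≤* {p} {q} 0≤p 0≤q = ℚ.nonNegative⁻¹ (p ℚ.* q)
    {{ℚ.nonNeg*nonNeg⇒nonNeg p {{ℚ.nonNegative 0≤p}} q {{ℚ.nonNegative 0≤q}}}}

  -- With x, y ≥ -δ, the product (x + δ)(y + δ) ≥ 0 gives xy ≥ -δ(x + y + δ).
  *-nonneg : ∀ {x y} → 0ℝ ≤ x → 0ℝ ≤ y → 0ℝ ≤ x * y
  *-nonneg {x} {y} (*≤* 0≤x) (*≤* 0≤y) = *≤* λ ε ε>0 →
    let (B , B>0 , M₁ , xB) = upper-bound x
        (C , C>0 , M₂ , yC) = upper-bound y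
        K>0 = ℚ.+-mono-< (ℚ.+-mono-< B>0 C>0) (ℚ.positive⁻¹ 1ℚ)
        K = B ℚ.+ C ℚ.+ 1ℚ
        (K′ , KK′≡1 , K′>0) = inv K K>0
        -- `δ ≤ 1` keeps `p + q + δ` below `K`, and `δ ≤ ε / K` then keeps the error term below `ε`.
        δ = 1ℚ ℚ.⊓ (K′ ℚ.* ε)
        δ>0 : 0ℚ ℚ.< δ
        δ>0 = ⊓-pos (ℚ.positive⁻¹ 1ℚ) (pos* K′>0 ε>0)
        (N₁ , h₁) = 0≤x δ δ>0
        (N₂ , h₂) = 0≤y δ δ>0
        M = M₁ ℕ.⊔ M₂ ; N = N₁ ℕ.⊔ N₂ in
    M ℕ.⊔ N , λ n ≤n →
      let M≤n = ℕ.m⊔n≤o⇒m≤o M N ≤n ; N≤n = ℕ.m⊔n≤o⇒n≤o M N ≤n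
          p = seq x n ; q = seq y n
          δK≤ε : δ ℚ.* (p ℚ.+ q ℚ.+ δ) ℚ.≤ ε
          δK≤ε = let open ℚ.≤-Reasoning in begin
            δ ℚ.* (p ℚ.+ q ℚ.+ δ) ≤⟨ ℚ.*-monoˡ-≤-nonNeg δ {{ℚ.nonNegative (ℚ.<⇒≤ δ>0)}}
              (ℚ.+-mono-≤ (ℚ.+-mono-≤ (xB n (ℕ.m⊔n≤o⇒m≤o M₁ M₂ M≤n)) (yC n (ℕ.m⊔n≤o⇒n≤o M₁ M₂ M≤n)))
                (ℚ.p⊓q≤p 1ℚ (K′ ℚ.* ε))) ⟩
            δ ℚ.* K               ≤⟨ ℚ.*-monoʳ-≤-nonNeg K {{ℚ.nonNegative (ℚ.<⇒≤ K>0)}}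
              (ℚ.p⊓q≤q 1ℚ (K′ ℚ.* ε)) ⟩
            K′ ℚ.* ε ℚ.* K        ≡⟨ solve 3 (λ a b c → a :* b :* c := c :* a :* b) ≡.refl K′ ε K ⟩
            K ℚ.* K′ ℚ.* ε        ≡⟨ cong (ℚ._* ε) KK′≡1 ⟩
            1ℚ ℚ.* ε              ≡⟨ ℚ.*-identityˡ ε ⟩
            ε                     ∎
      in let open ℚ.≤-Reasoning in begin
      0ℚ                                    ≤⟨ 0≤*
        (h₁ n (ℕ.m⊔n≤o⇒m≤o N₁ N₂ N≤n)) (h₂ n (ℕ.m⊔n≤o⇒n≤o N₁ N₂ N≤n)) ⟩
      (p ℚ.+ δ) ℚ.* (q ℚ.+ δ)               ≡⟨ solve 3 (λ p q δ →
        (p :+ δ) :* (q :+ δ) := p :* q :+ δ :* (p :+ q :+ δ)) ≡.refl p q δ ⟩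
      p ℚ.* q ℚ.+ δ ℚ.* (p ℚ.+ q ℚ.+ δ)     ≤⟨ ℚ.+-monoʳ-≤ (p ℚ.* q) δK≤ε ⟩
      p ℚ.* q ℚ.+ ε                         ∎
    where
    ⊓-pos : ∀ {p q} → 0ℚ ℚ.< p → 0ℚ ℚ.< q → 0ℚ ℚ.< p ℚ.⊓ q
    ⊓-pos {p} {q} p>0 q>0 with ℚ.⊓-sel p q
    ... | inj₁ eq = subst (0ℚ ℚ.<_) (≡.sym eq) p>0
    ... | inj₂ eq = subst (0ℚ ℚ.<_) (≡.sym eq) q>0

  -- Neither sign of z is known, so write (x - y) z = (x - y)(B + z) + (y - x) B
  -- with B + z ≥ 0.
  *-congʳ-≤ : ∀ {x y} z → x ≃ y → y * z ≤ x * z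
  *-congʳ-≤ {x} {y} z (x≤y , y≤x) with upper-bound (- z)
  ... | B , B>0 , N , h = ≤-trans (pointwise-≤ λ n → ℚ.≤-reflexive (≡.sym (ℚ.+-identityˡ _)))
      (≤-trans (+-mono-≤ (+-mono-≤ (*-nonneg (0≤- y≤x) 0≤B+z) (*-nonneg (0≤- x≤y) 0≤B)) (≤-refl {y * z}))
        (pointwise-≤ λ n → ℚ.≤-reflexive (solve 4 (λ x y z B →
          (x :- y) :* (B :+ z) :+ (y :- x) :* B :+ y :* z := x :* z) ≡.refl
          (seq x n) (seq y n) (seq z n) B)))
    where
    0≤- : ∀ {x y} → x ≤ y → 0ℝ ≤ y - x
    0≤- {x} {y} x≤y = ≤-trans (pointwise-≤ λ n → ℚ.≤-reflexive (≡.sym (ℚ.+-inverseʳ (seq x n))))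
      (+-mono-≤ x≤y (≤-refl { - x}))
    0≤B : 0ℝ ≤ fromℚ B
    0≤B = pointwise-≤ λ n → ℚ.<⇒≤ B>0
    0≤B+z : 0ℝ ≤ fromℚ B + z
    0≤B+z = *≤* λ ε ε>0 → N , λ n N≤n → let open ℚ.≤-Reasoning in begin
      0ℚ                          ≡⟨ ≡.sym (ℚ.+-inverseˡ (seq z n)) ⟩
      ℚ.- seq z n ℚ.+ seq z n     ≤⟨ ℚ.+-monoˡ-≤ (seq z n) (h n N≤n) ⟩
      B ℚ.+ seq z n               ≡⟨ ≡.sym (ℚ.+-identityʳ _) ⟩
      B ℚ.+ seq z n ℚ.+ 0ℚ        ≤⟨ ℚ.+-monoʳ-≤ (B ℚ.+ seq z n) (ℚ.<⇒≤ ε>0) ⟩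
      B ℚ.+ seq z n ℚ.+ ε         ∎

  ≃-isEquivalence : IsEquivalence _≃_
  ≃-isEquivalence = record
    { refl  = ≤-refl , ≤-refl
    ; sym   = λ (x≤y , y≤x) → y≤x , x≤y
    ; trans = λ (x≤y , y≤x) (y≤z , z≤y) → ≤-trans x≤y y≤z , ≤-trans z≤y y≤x
    }

  open IsEquivalence ≃-isEquivalence using () renaming (sym to ≃-sym; trans to ≃-trans)

  *-congʳ : ∀ {x y} z → x ≃ y → x * z ≃ y * z
  *-congʳ z x≃y = *-congʳ-≤ z (≃-sym x≃y) , *-congʳ-≤ z x≃y

  *-comm : ∀ x y → x * y ≃ y * x
  *-comm x y = pointwise-≃ λ n → ℚ.*-comm (seq x n) (seq y n)

  *-cong : ∀ {x y u v} → x ≃ y → u ≃ v → x * u ≃ y * v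
  *-cong {x} {y} {u} {v} x≃y u≃v = ≃-trans (*-congʳ u x≃y)
    (≃-trans (*-comm y u) (≃-trans (*-congʳ y u≃v) (*-comm v y)))

  -‿cong : ∀ {x y} → x ≃ y → - x ≃ - y
  -‿cong {x} {y} (x≤y , y≤x) = neg-mono y≤x , neg-mono x≤y
    where
    neg-mono : ∀ {x y} → x ≤ y → - y ≤ - x
    neg-mono {x} {y} x≤y = ≤-trans (pointwise-≤ λ n → ℚ.≤-reflexive
        (solve 2 (λ x y → :- y := x :+ (:- x :- y)) ≡.refl (seq x n) (seq y n)))
      (≤-trans (+-mono-≤ x≤y (≤-refl { - x - y})) (pointwise-≤ λ n → ℚ.≤-reflexive
        (solve 2 (λ x y → y :+ (:- x :- y) := :- x) ≡.refl (seq x n) (seq y n))))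

  isCommutativeRing : IsCommutativeRing _≃_ _+_ _*_ -_ 0ℝ 1ℝ
  isCommutativeRing = record
    { isRing = record
      { +-isAbelianGroup = record
        { isGroup = record
          { isMonoid = record
            { isSemigroup = record
              { isMagma = record
                { isEquivalence = ≃-isEquivalence
                ; ∙-cong        = λ (x≤y , y≤x) (u≤v , v≤u) → +-mono-≤ x≤y u≤v , +-mono-≤ y≤x v≤u
                }
              ; assoc = λ x y z → pointwise-≃ λ n → ℚ.+-assoc (seq x n) (seq y n) (seq z n)
              }
            ; identity = (λ x → pointwise-≃ λ n → ℚ.+-identityˡ (seq x n))
                       , (λ x → pointwise-≃ λ n → ℚ.+-identityʳ (seq x n))
            }
          ; inverse = (λ x → pointwise-≃ λ n → ℚ.+-inverseˡ (seq x n))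
                    , (λ x → pointwise-≃ λ n → ℚ.+-inverseʳ (seq x n))
          ; ⁻¹-cong = -‿cong
          }
        ; comm = λ x y → pointwise-≃ λ n → ℚ.+-comm (seq x n) (seq y n)
        }
      ; *-cong     = *-cong
      ; *-assoc    = λ x y z → pointwise-≃ λ n → ℚ.*-assoc (seq x n) (seq y n) (seq z n)
      ; *-identity = (λ x → pointwise-≃ λ n → ℚ.*-identityˡ (seq x n))
                   , (λ x → pointwise-≃ λ n → ℚ.*-identityʳ (seq x n))
      ; distrib    = (λ x y z → pointwise-≃ λ n → ℚ.*-distribˡ-+ (seq x n) (seq y n) (seq z n))
                   , (λ x y z → pointwise-≃ λ n → ℚ.*-distribʳ-+ (seq x n) (seq y n) (seq z n))
      }
    ; *-comm = *-comm
    }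

  orderedRing : OrderedRing
  orderedRing = record
    { commutativeRing = record { isCommutativeRing = isCommutativeRing }
    ; _≤_             = _≤_
    ; isPartialOrder  = record
      { isPreorder = record
        { isEquivalence = ≃-isEquivalence ; reflexive = proj₁ ; trans = ≤-trans }
      ; antisym = _,_
      }
    ; +-mono-≤   = +-mono-≤
    ; *-nonneg   = *-nonneg
    ; 0≤1        = pointwise-≤ λ _ → ℚ.<⇒≤ (ℚ.positive⁻¹ 1ℚ)
    -- With tolerance ½ the inequality would give 1 ≤ ½ at some index.
    ; 1≰0        = λ (*≤* 1≤0) → let (N , h) = 1≤0 ½ (ℚ.positive⁻¹ ½) in
        ℚ.<-irrefl ≡.refl (ℚ.<-≤-trans ½<1 (h N ℕ.≤-refl))
    ; fromℕ      = fromℕ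
    ; fromℕ-zero = pointwise-≃ λ _ → ≡.refl
    ; fromℕ-suc  = λ k → pointwise-≃ λ _ → fromℚ-suc k
    }
    where
    ½<1 : 0ℚ ℚ.+ ½ ℚ.< 1ℚ
    ½<1 = ℚ.*<* (ℤ.+<+ (ℕ.s≤s (ℕ.s≤s ℕ.z≤n)))
    -- The fractions are normalised by a gcd that does not compute for a variable `k`, so they are
    -- compared as unnormalised rationals.
    fromℚ-suc : ∀ k → ℤ.+ ℕ.suc k ℚ./ 1 ≡ 1ℚ ℚ.+ ℤ.+ k ℚ./ 1
    fromℚ-suc k = ℚ.toℚᵘ-injective (begin
      ℚ.toℚᵘ (ℤ.+ ℕ.suc k ℚ./ 1)                   ≈⟨ ℚ.toℚᵘ-fromℚᵘ (ℚᵘ.mkℚᵘ (ℤ.+ ℕ.suc k) 0) ⟩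
      ℚᵘ.mkℚᵘ (ℤ.+ ℕ.suc k) 0                      ≈⟨ ℚᵘ.*≡* (cong (λ i → (ℤ.1ℤ ℤ.+ i) ℤ.* ℤ.1ℤ)
                                                      (≡.sym (ℤ.*-identityʳ (ℤ.+ k)))) ⟩
      ℚᵘ.1ℚᵘ ℚᵘ.+ ℚᵘ.mkℚᵘ (ℤ.+ k) 0              ≈⟨ ℚᵘ.+-congʳ ℚᵘ.1ℚᵘ
                                                      (ℚ.toℚᵘ-fromℚᵘ (ℚᵘ.mkℚᵘ (ℤ.+ k) 0)) ⟨
      ℚᵘ.1ℚᵘ ℚᵘ.+ ℚ.toℚᵘ (ℤ.+ k ℚ./ 1)           ≈⟨ ℚ.toℚᵘ-homo-+ 1ℚ (ℤ.+ k ℚ./ 1) ⟨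
      ℚ.toℚᵘ (1ℚ ℚ.+ ℤ.+ k ℚ./ 1)                ∎)
      where open import Relation.Binary.Reasoning.Setoid ℚᵘ.≃-setoid

open RealNumbers using (orderedRing; pointwise-≤; pointwise-≃)
open OrderedRingProperties orderedRing
open Fractional orderedRing using (marginal; weight-marginal; module SubDistribution)

-- The approximation constant

module Ratio where
  open import Data.Rational.Solver using (module +-*-Solver)
  open +-*-Solver using (solve; _:=_; _:+_; _:*_; con)

  -- Holds at every index, including 0 where the partial sum is 0: the proof of `e>0` supplies the
  -- gap 1, so the terms of `e⁻¹` are 1 / (1 ⊔ `expSum n`).
  0≤1-e⁻¹≤1 : ∀ n → 0ℚ ℚ.≤ seq (1ℝ - e⁻¹) n × seq (1ℝ - e⁻¹) n ℚ.≤ 1ℚ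
  0≤1-e⁻¹≤1 n = ℚ.≤-trans (ℚ.≤-reflexive (≡.sym (ℚ.+-inverseʳ r))) (ℚ.+-monoˡ-≤ (ℚ.- r) r≤1)
              , ℚ.≤-trans (ℚ.+-monoʳ-≤ 1ℚ (ℚ.neg-antimono-≤ 0≤r)) (ℚ.≤-reflexive (ℚ.+-identityʳ 1ℚ))
    where
    1>0 = ℚ.positive⁻¹ 1ℚ
    q = 1ℚ ℚ.⊔ expSum n
    r = seq e⁻¹ n
    0≤r : 0ℚ ℚ.≤ r
    0≤r = ℚ.<⇒≤ (CauchyLemmas.recip-pos 1ℚ 1>0 (expSum n))
    r≤1 : r ℚ.≤ 1ℚ
    r≤1 = let open ℚ.≤-Reasoning in begin
      r          ≡⟨ ≡.sym (ℚ.*-identityˡ r) ⟩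
      1ℚ ℚ.* r   ≤⟨ ℚ.*-monoʳ-≤-nonNeg r {{ℚ.nonNegative 0≤r}} (ℚ.p≤p⊔q 1ℚ (expSum n)) ⟩
      q ℚ.* r    ≡⟨ proj₁ (proj₂ (CauchyLemmas.inv q (CauchyLemmas.⊔-pos 1>0 (expSum n)))) ⟩
      1ℚ         ∎

  ratio : ℝ
  ratio = fromℚ ½ * ((1ℝ - e⁻¹) * (1ℝ - e⁻¹))

  0≤ratio : 0ℝ ≤ ratio
  0≤ratio = pointwise-≤ λ n → let (0≤c , _) = 0≤1-e⁻¹≤1 n in
    RealNumbers.0≤* (ℚ.<⇒≤ (ℚ.positive⁻¹ ½)) (RealNumbers.0≤* 0≤c 0≤c)

  ratio≤½ : ratio ≤ fromℚ ½
  ratio≤½ = pointwise-≤ λ n → let (0≤c , c≤1) = 0≤1-e⁻¹≤1 n in ℚ.≤-trans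
    (ℚ.*-monoˡ-≤-nonNeg ½ (CauchyLemmas.*-mono (ℚ.<⇒≤ (ℚ.positive⁻¹ 1ℚ)) 0≤c c≤1 c≤1))
    (ℚ.≤-reflexive (ℚ.*-identityʳ ½))

  half-double : ∀ x → fromℚ ½ * (x + x) ≃ x
  half-double x = pointwise-≃ λ n → solve 1 (λ x → con ½ :* (x :+ x) := x) ≡.refl (seq x n)

  -- The constant is relaxed to ½ only after `x` has been replaced by `y + y`, which is known to be
  -- non-negative.
  ratio*≤ : ∀ {x y} → 0ℝ ≤ y → x ≤ y + y → ratio * x ≤ y
  ratio*≤ {x} {y} 0≤y x≤2y = begin
    ratio * x            ≤⟨ *-monoʳ-≤ 0≤ratio x≤2y ⟩
    ratio * (y + y)      ≤⟨ *-monoˡ-≤ (≤-trans 0≤y (x≤y+x 0≤y)) ratio≤½ ⟩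
    fromℚ ½ * (y + y)    ≈⟨ half-double y ⟩
    y                    ∎
    where open import Relation.Binary.Reasoning.PartialOrder poset

-- The greedy output compared with a solution of P.0

module Run {n : ℕ} (f : Subset n → ℝ) (I : Subset n → Set) where
  open Greedy f I

  run-⊆ : ∀ {S A} → Star Step S A → S ⊆ A
  run-⊆ Star.ε = id
  run-⊆ ((v , _ , _ , ≡.refl) ◅ run) = run-⊆ run ∘ p⊆p∪q ⁅ v ⁆

  run-∈ : ∀ {S A} → Star Step S A → I S → I A
  run-∈ Star.ε IS = IS
  run-∈ ((_ , (_ , IS′) , _ , ≡.refl) ◅ run) _ = run-∈ run IS′

module OptimalVsGreedy {n m b : ℕ} {f : Subset n → ℝ}
  (0≤f : Nonnegative f) (f-mono : Monotone f) (f-sub : Submodular f)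
  {V : Fin m → Subset n} (isPartition : IsPartition V) {α β : Fin m → ℝ} {lo hi : Fin m → ℕ}
  (lo-floor : ∀ t → IsFloor (α t) (lo t)) (hi-ceil : ∀ t → IsCeiling (β t) (hi t))
  {x : Subset n → ℝ} (feasible : P0.IsFeasible f V α β b x)
  {A : Subset n} (output : Greedy.IsOutput f (𝓘 V lo hi b) A) where

  open P0.IsFeasible feasible
  open Greedy f (𝓘 V lo hi b) using (Step)
  open Run f (𝓘 V lo hi b)

  ∈𝓕⇒∣∣≤b : ∀ {S} → S List.∈ 𝓕 b → ∣ S ∣ ℕ.≤ b
  ∈𝓕⇒∣∣≤b S∈ = proj₂ (∈-filter⁻ (λ S → ∣ S ∣ ℕ.≤? b) {xs = subsets n} S∈)

  open SubDistribution (𝓕 b) x (λ S∈ → proj₁ (in-[0,1] _ (∈𝓕⇒∣∣≤b S∈))) total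

  y : Fin n → ℝ
  y = marginal (𝓕 b) x

  -- Rounding α down, and β up in `y≤hi`, only loosens the constraints, so the marginals meet the
  -- integer quotas.
  lo≤y : ∀ t → fromℕ (lo t) ≤ weight y (V t)
  lo≤y t = ≤-trans (proj₁ (lo-floor t)) (≤-trans (lower t) (≤-reflexive (weight-marginal x (𝓕 b) (V t))))

  y≤hi : ∀ t → weight y (V t) ≤ fromℕ (hi t)
  y≤hi t = ≤-trans (≤-reflexive (OrderedRing.sym orderedRing (weight-marginal x (𝓕 b) (V t))))
    (≤-trans (upper t) (proj₁ (hi-ceil t)))

  -- Feasibility of `x` makes the quotas compatible: the weight of each group lies between them.
  open PartitionFamily isPartition {lo} {hi} {b} (λ t → fromℕ-cancel-≤ (≤-trans (lo≤y t) (y≤hi t)))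
  open Rank orderedRing y 0≤marginal marginal≤1 lo≤y y≤hi (weight-⊤≤ ∈𝓕⇒∣∣≤b)
  open Marginals orderedRing f f-mono f-sub
  open GreedyChain I (𝓘? V lo hi b) 0≤f 𝓘-downward y 0≤marginal rank A

  run : Star Step ∅ A
  run = proj₁ output

  -- The lower quotas sum to at most the total marginal weight, hence to at most `b`.
  I∅ : I ∅
  I∅ = 𝓘-∅ (fromℕ-cancel-≤ (≤-trans (≤-reflexive (fromℕ-sum lo)) (≤-trans (sum-mono lo≤y) weight-V)))

  IA : I A
  IA = run-∈ run I∅

  -- Recursion runs to the end of the algorithm, where maximality of `A` applies; the rest of the
  -- run also shows that the current set is contained in `A`.
  run⇒Bound : ∀ {S} → Star Step S A → I S → Bound S
  run⇒Bound Star.ε IS = bound-maximal IS (proj₂ output)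
  run⇒Bound ((v , addable , greedy , ≡.refl) ◅ run) IS =
    bound-step IS (run-⊆ run ∘ p⊆p∪q ⁅ v ⁆) greedy addable (run⇒Bound run (proj₂ addable))

  lo≤ : ∀ t → lo t ℕ.≤ ∣ A ∩ V t ∣
  -- Each group has at least `lo t` elements, as its weight is at least `lo t` and no marginal
  -- exceeds 1.
  lo≤ = maximal⇒lo≤ (λ t → fromℕ-cancel-≤ (≤-trans (lo≤y t) (weight≤∣∣ (V t) marginal≤1)))
    IA (proj₂ output)

  ∣A∣≤b : ∣ A ∣ ℕ.≤ b
  ∣A∣≤b = ℕ.≤-trans (ℕ.≤-reflexive (≡.sym (∣∣-partition isPartition A)))
    (ℕ.≤-trans (sumℕ-mono λ t → ℕ.m≤n⊔m (lo t) ∣ A ∩ V t ∣) (proj₂ IA))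

  -- One `f A` is the constant term of the averaged submodularity bound, the other bounds the
  -- weighted gains over `A`.
  objective≤2f : P0.objective f V α β b x ≤ f A + f A
  objective≤2f = ≤-trans (listSum-≤-affine f (gain A) (0≤f A) (f≤f+gains A))
    (RealNumbers.+-mono-≤ ≤-refl (bound-∅ (run⇒Bound run I∅)))

theorem2 : (n m b : ℕ) → .{{_ : NonZero b}} →
    (f : Subset n → ℝ) → Nonnegative f → Monotone f → Submodular f →
    (V : Fin m → Subset n) → IsPartition V →
    (α β : Fin m → ℝ) → (∀ t → 0ℝ ≤ α t) → (∀ t → 0ℝ ≤ β t) →
    (⌊α⌋ ⌈β⌉ : Fin m → ℕ) →
    (∀ t → IsFloor (α t) (⌊α⌋ t)) → (∀ t → IsCeiling (β t) (⌈β⌉ t)) →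
    (OPT : ℝ) → P0.IsOptimalValue f V α β b OPT →
    (A : Subset n) → Greedy.IsOutput f (𝓘 V ⌊α⌋ ⌈β⌉ b) A →
    ∣ A ∣ ℕ.≤ b
    × (∀ t → ⌊α⌋ t ℕ.≤ ∣ A ∩ V t ∣ × ∣ A ∩ V t ∣ ℕ.≤ ⌈β⌉ t)
    × (fromℚ ½ * ((1ℝ - e⁻¹) * (1ℝ - e⁻¹))) * OPT ≤ f A
theorem2 n m b f 0≤f f-mono f-sub V isPartition α β _ _ lo hi lo-floor hi-ceil
    OPT (x , (feasible , _) , _ , OPT≤) A output =
  ∣A∣≤b , (λ t → lo≤ t , proj₁ IA t) , Ratio.ratio*≤ (0≤f A) (≤-trans OPT≤ objective≤2f)
  where open OptimalVsGreedy 0≤f f-mono f-sub isPartition lo-floor hi-ceil feasible output
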